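{- Let $f\in\mathbb{Q}(x)$ be a normalized Belyi map of combinatorial type $(d; e_1,e_2,e_3)$. Suppose there is a prime $p$ and an integer $\ell$ such that at least one of the following holds: (1) $p=2$, $2\mid d$ and $\ell=\nu_2(d)$; (2) $p=3$, $3\mid d$ and $\ell=\nu_3(d)$; (3) $d=p^\ell$. Assume moreover that $e_2\le p^\ell$. Then $\mathrm{PrePer}(f,\mathbb{Q})$ consists entirely of the rational fixed points of $f$ and their rational preimages; that is, every periodic point of $f$ in $\mathbb{P}^1(\mathbb{Q})$ is a fixed point, so every $P\in\mathrm{PrePer}(f,\mathbb{Q})$ satisfies $f^m(P)=f^{m+1}(P)$ for some $m\ge 0$.
   Context: A normalized Belyi map of combinatorial type $(d; e_1,e_2,e_3)$ (with integers $2\le e_i\le d$, $e_1+e_2+e_3=2d+1$) is a rational function $f$ of degree $d$, viewed as a map $\mathbb{P}^1\to\mathbb{P}^1$ over $\mathbb{C}$, whose only ramification points are $0,1,\infty$, with ramification indices $e_1,e_2,e_3$ respectively, and with $f(0)=0$, $f(1)=1$, $f(\infty)=\infty$; such $f$ has rational coefficients. $\nu_p$ denotes the $p$-adic valuation. $f^n$ is the $n$-fold iterate of $f$. A point $P$ is preperiodic if $f^n(P)=f^m(P)$ for some integers $n\ne m\ge 0$, and $\mathrm{PrePer}(f,\mathbb{Q})$ is the set of preperiodic points of $f$ in $\mathbb{P}^1(\mathbb{Q})$. -}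

module Defs where

open import Data.Nat as ℕ using (ℕ; zero; suc; _≤_; _∸_)
open import Data.Nat.Divisibility using (_∣_)
open import Data.Integer using (+_)
open import Data.Rational using (ℚ; 0ℚ; 1ℚ; _+_; _*_; _-_; _÷_; _/_; ≢-nonZero)
open import Data.Rational.Properties using (_≟_)
open import Data.List using (List; []; _∷_; length; last)
open import Data.Maybe using (just)
open import Data.Product using (Σ; _×_; ∃; ∃-syntax)
open import Relation.Binary.PropositionalEquality using (_≡_; _≢_)
open import Relation.Nullary using (¬_; yes; no)

-- Polynomials over ℚ as coefficient lists, lowest degree first.

Poly : Set
Poly = List ℚ

ev : Poly → ℚ → ℚ
ev []       x = 0ℚ
ev (a ∷ as) x = a + x * ev as x

ℕ→ℚ : ℕ → ℚ
ℕ→ℚ n = (+ n) / 1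

_^ℚ_ : ℚ → ℕ → ℚ
x ^ℚ zero  = 1ℚ
x ^ℚ suc n = x * (x ^ℚ n)

derivAux : ℕ → Poly → Poly
derivAux k []       = []
derivAux k (b ∷ bs) = (ℕ→ℚ k * b) ∷ derivAux (suc k) bs

deriv : Poly → Poly
deriv []       = []
deriv (a ∷ as) = derivAux 1 as

HasDegree : Poly → ℕ → Set
HasDegree p n = (length p ≡ suc n) × (last p ≢ just 0ℚ)

-- A rational function f = P/Q with P, Q ∈ ℚ[x] (in lowest terms) is a
-- normalized Belyi map of combinatorial type (d; e₁, e₂, e₃).
-- (Polynomial identities are stated as equality of polynomial functions
-- on ℚ, which is equivalent to coefficientwise equality since ℚ is
-- infinite.)

record IsNormalizedBelyi (d e₁ e₂ e₃ : ℕ) (P Q : Poly) : Set where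
  field
    2≤e₁ : 2 ≤ e₁
    2≤e₂ : 2 ≤ e₂
    2≤e₃ : 2 ≤ e₃
    e₁≤d : e₁ ≤ d
    e₂≤d : e₂ ≤ d
    e₃≤d : e₃ ≤ d
    sum-e : e₁ ℕ.+ e₂ ℕ.+ e₃ ≡ 2 ℕ.* d ℕ.+ 1
    coprime : ∃[ A ] ∃[ B ] (∀ x → ev A x * ev P x + ev B x * ev Q x ≡ 1ℚ)
    -- degrees: deg f = d and f(∞) = ∞ with ramification index e₃
    degP : HasDegree P d
    degQ : HasDegree Q (d ∸ e₃)
    -- f(0) = 0 with ramification index e₁
    ram0 : ∃[ P₁ ] ((∀ x → ev P x ≡ (x ^ℚ e₁) * ev P₁ x) × (ev P₁ 0ℚ ≢ 0ℚ))
    -- f(1) = 1 with ramification index e₂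
    ram1 : ∃[ R ] ((∀ x → ev P x - ev Q x ≡ ((x - 1ℚ) ^ℚ e₂) * ev R x)
                   × (ev R 1ℚ ≢ 0ℚ))
    -- no critical points other than 0, 1 (and ∞): the numerator of f'
    -- is c · x^(e₁-1) (x-1)^(e₂-1) with c ≠ 0
    crit : ∃[ c ] ((c ≢ 0ℚ) ×
             (∀ x → ev (deriv P) x * ev Q x - ev P x * ev (deriv Q) x
                    ≡ c * ((x ^ℚ (e₁ ∸ 1)) * ((x - 1ℚ) ^ℚ (e₂ ∸ 1)))))

data ℙ¹ : Set where
  fin : ℚ → ℙ¹
  ∞   : ℙ¹

-- (for deg P > deg Q, as for a normalized Belyi map, f(∞) = ∞)
act : Poly → Poly → ℙ¹ → ℙ¹
act P Q ∞ = ∞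
act P Q (fin x) with ev Q x ≟ 0ℚ
... | yes _  = ∞
... | no q≢0 = fin (_÷_ (ev P x) (ev Q x) {{≢-nonZero q≢0}})

iter : {A : Set} → (A → A) → ℕ → A → A
iter g zero    a = a
iter g (suc n) a = g (iter g n a)

IsPreperiodic : (ℙ¹ → ℙ¹) → ℙ¹ → Set
IsPreperiodic g x = ∃[ n ] ∃[ m ] ((n ≢ m) × (iter g n x ≡ iter g m x))

ValIs : ℕ → ℕ → ℕ → Set
ValIs p d ℓ = (p ℕ.^ ℓ ∣ d) × ¬ (p ℕ.^ suc ℓ ∣ d)

{-# OPTIONS --safe #-}
-- Write P = x^e₁ P₁ and P − Q = (x − 1)^e₂ R.  Since deg P₁ + deg Q = e₂ − 1, the pair (Q, P₁) is a
-- Padé approximant of x^e₁ at x = 1, and such approximants are unique up to scaling, also modulo p.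
-- Modulo p the polynomial (x − 1)^(p^ℓ), hence (x − 1)^e₂, divides x^d − 1, so (1, x^(d − e₁)) is one:
-- after scaling, P ≡ x^d and Q ≡ 1, i.e. f reduces to x^d.  Because p ∣ d, f strictly contracts
-- p-adically on every residue disc, and in each of the three cases x ↦ x^d is idempotent on ℙ¹(𝔽_p);
-- hence consecutive points of a periodic orbit agree modulo p, and therefore coincide.
module Submission where

open import Defs
open import Data.Nat as ℕ using (ℕ; zero; suc; _≤_; _^_; z≤n; s≤s)
import Data.Nat.Properties as ℕₚ
import Data.Nat.Coprimality as Coprimality
open import Data.Nat.Combinatorics
  using (_C_; nCk+nC[k+1]≡[n+1]C[k+1]; k>n⇒nCk≡0; nCn≡1; nCk≡n!/k![n-k]!; k![n∸k]!∣n!)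
open import Data.Nat.Divisibility using (_∣_; _∤_; divides; ∣⇒≤; m∣m*n; _∣?_)
open import Data.Nat.DivMod using (m/n*n≡m)
open import Data.Nat.Primality using (Prime; euclidsLemma; prime⇒nonZero; prime⇒nonTrivial)
import Data.Nat.Solver as NatSolver
open import Data.Integer as ℤ using (ℤ; ∣_∣)
import Data.Integer.Properties as ℤₚ
import Data.Integer.Divisibility.Signed as ℤₛ
open import Data.Rational as ℚ using (ℚ; 0ℚ; 1ℚ; _+_; _*_; _-_; -_; toℚᵘ; ↥_; ↧_; 1/_; ≢-nonZero)
open import Data.Rational.Properties as ℚₚ using (_≟_)
import Data.Rational.Unnormalised as ℚᵘ
import Data.Rational.Unnormalised.Properties as ℚᵘₚ
import Data.Rational.Solver as RationalSolver
open import Data.List using ([]; _∷_; _++_; length; map; drop)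
open import Data.List.Properties using (length-map; length-++; length-drop; map-++)
open import Data.List.Relation.Unary.All as All using (All; []; _∷_)
import Data.List.Relation.Unary.All.Properties as Allₚ
open import Data.List.Relation.Unary.Any using (Any; here; there)
import Data.List.Relation.Unary.Any.Properties as Anyₚ
open import Data.Product using (Σ; _×_; _,_; proj₁; proj₂; ∃-syntax)
open import Data.Sum as Sum using (_⊎_; inj₁; inj₂; [_,_]′)
open import Data.Empty using (⊥-elim)
open import Function using (id; _∘_)
open import Relation.Binary.Definitions using (tri<; tri≈; tri>)
open import Relation.Binary.PropositionalEquality
open import Relation.Nullary using (¬_; Dec; yes; no)

open ≡-Reasoning
open RationalSolver.+-*-Solver using (solve; con; _:=_; _:+_; _:*_; _:-_; :-_)
module ℕS = NatSolver.+-*-Solver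

-- The hypotheses are identities of functions on ℚ, whereas reduction modulo p concerns
-- coefficients; the bridge is that a polynomial vanishing at infinitely many integers has only zero
-- coefficients. Good reduction is not given: P₁ and Q are scaled together until all coefficients
-- are p-integral and one equals 1, and the Padé congruences then rule out a constant coefficient of
-- Q divisible by p, since it would drag every other coefficient along. Valuations are replaced by
-- explicit factors: contraction reads δ′ = δc with c in pℤ₍ₚ₎, so one turn around a cycle gives δ =
-- δc, where 1 - c is a unit. Points with p in the denominator lie in the residue disc of ∞; there
-- the reciprocal of the point picks up such a factor at every step, because e₃ ≥ 2, so no finite
-- point of this disc is periodic.

ι : ℤ → ℚ
ι n = n ℚ./ 1

ι-toℚᵘ : ∀ n → toℚᵘ (ι n) ℚᵘ.≃ ℚᵘ.mkℚᵘ n 0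
ι-toℚᵘ n = ℚₚ.toℚᵘ-fromℚᵘ (ℚᵘ.mkℚᵘ n 0)

ι-injective : ∀ {a b} → ι a ≡ ι b → a ≡ b
ι-injective {a} {b} eq with ℚₚ.fromℚᵘ-injective {ℚᵘ.mkℚᵘ a 0} {ℚᵘ.mkℚᵘ b 0} eq
... | ℚᵘ.*≡* e = trans (sym (ℤₚ.*-identityʳ a)) (trans e (ℤₚ.*-identityʳ b))

ι-+ : ∀ a b → ι (a ℤ.+ b) ≡ ι a + ι b
ι-+ a b = ℚₚ.toℚᵘ-injective (ℚᵘₚ.≃-trans (ι-toℚᵘ (a ℤ.+ b)) (ℚᵘₚ.≃-sym (ℚᵘₚ.≃-trans (ℚₚ.toℚᵘ-homo-+ (ι a) (ι b))
  (ℚᵘₚ.≃-trans (ℚᵘₚ.+-cong (ι-toℚᵘ a) (ι-toℚᵘ b)) (ℚᵘ.*≡* (cong (ℤ._* ℤ.+ 1) (cong₂ ℤ._+_ (ℤₚ.*-identityʳ a) (ℤₚ.*-identityʳ b))))))))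

ι-* : ∀ a b → ι (a ℤ.* b) ≡ ι a * ι b
ι-* a b = ℚₚ.toℚᵘ-injective (ℚᵘₚ.≃-trans (ι-toℚᵘ (a ℤ.* b)) (ℚᵘₚ.≃-sym (ℚᵘₚ.≃-trans (ℚₚ.toℚᵘ-homo-* (ι a) (ι b))
  (ℚᵘₚ.*-cong (ι-toℚᵘ a) (ι-toℚᵘ b)))))

ι-num-den : ∀ x → x * ι (↧ x) ≡ ι (↥ x)
ι-num-den x = ℚₚ.toℚᵘ-injective (ℚᵘₚ.≃-trans (ℚₚ.toℚᵘ-homo-* x (ι (↧ x))) (ℚᵘₚ.≃-trans (ℚᵘₚ.*-congˡ {toℚᵘ x} (ι-toℚᵘ (↧ x)))
  (ℚᵘₚ.≃-trans (ι-num-denᵘ x) (ℚᵘₚ.≃-sym (ι-toℚᵘ (↥ x))))))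
  where
  ι-num-denᵘ : ∀ x → toℚᵘ x ℚᵘ.* ℚᵘ.mkℚᵘ (↧ x) 0 ℚᵘ.≃ ℚᵘ.mkℚᵘ (↥ x) 0
  ι-num-denᵘ (ℚ.mkℚ n d-1 _) = ℚᵘ.*≡* (trans (ℤₚ.*-identityʳ (n ℤ.* ℤ.+ suc d-1)) (cong (λ k → n ℤ.* ℤ.+ suc k) (sym (ℕₚ.*-identityʳ d-1))))

-- Prime divisors of factorials and binomial coefficients

prime∣!⇒≤ : ∀ {p m} → Prime p → p ∣ (m ℕ.!) → p ≤ m
prime∣!⇒≤ {p} {zero} pp h = ⊥-elim (ℕₚ.<⇒≱ (ℕ.nonTrivial⇒n>1 p {{prime⇒nonTrivial pp}}) (∣⇒≤ h))
prime∣!⇒≤ {p} {suc m} pp h with euclidsLemma (suc m) (m ℕ.!) pp h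
... | inj₁ x = ∣⇒≤ x
... | inj₂ x = ℕₚ.≤-trans (prime∣!⇒≤ pp x) (ℕₚ.n≤1+n m)

n∣n! : ∀ n → .{{ℕ.NonZero n}} → n ∣ n ℕ.!
n∣n! (suc n) = m∣m*n (n ℕ.!)

-- p divides p! = C(p,k) · k! · (p - k)!, but neither factorial, since k and p - k are both below p.
prime∣C : ∀ {p k} → Prime p → 0 ℕ.< k → k ℕ.< p → p ∣ p C k
prime∣C {p} {k} pp 0<k k<p
  with euclidsLemma (p C k) (k ℕ.! ℕ.* (p ℕ.∸ k) ℕ.!) pp
         (subst (p ∣_) (sym eq) (n∣n! p {{prime⇒nonZero pp}}))
  where
  instance _ = ℕₚ._!*_!≢0 k (p ℕ.∸ k)
  eq : (p C k) ℕ.* (k ℕ.! ℕ.* (p ℕ.∸ k) ℕ.!) ≡ p ℕ.!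
  eq = trans (cong (ℕ._* (k ℕ.! ℕ.* (p ℕ.∸ k) ℕ.!)) (nCk≡n!/k![n-k]! (ℕₚ.<⇒≤ k<p)))
             (m/n*n≡m (k![n∸k]!∣n! (ℕₚ.<⇒≤ k<p)))
... | inj₁ x = x
... | inj₂ x with euclidsLemma (k ℕ.!) _ pp x
...   | inj₁ y = ⊥-elim (ℕₚ.<⇒≱ k<p (prime∣!⇒≤ pp y))
...   | inj₂ y = ⊥-elim (ℕₚ.<⇒≱ (ℕₚ.∸-monoʳ-< 0<k (ℕₚ.<⇒≤ k<p)) (prime∣!⇒≤ pp y))

-- Cancellation and powers in ℚ

inv : ∀ x → x ≢ 0ℚ → ∃[ y ] (x * y ≡ 1ℚ)
inv x x≢0 = (1/ x) {{≢-nonZero x≢0}} , ℚₚ.*-inverseʳ x {{≢-nonZero x≢0}}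

cancel-unit : ∀ x t y z → x * t ≡ 1ℚ → x * y ≡ x * z → y ≡ z
cancel-unit x t y z u e = begin
  y           ≡⟨ sym (ℚₚ.*-identityˡ y) ⟩
  1ℚ * y      ≡⟨ cong (_* y) (sym u) ⟩
  x * t * y   ≡⟨ solve 3 (λ x t y → x :* t :* y := t :* (x :* y)) refl x t y ⟩
  t * (x * y) ≡⟨ cong (t *_) e ⟩
  t * (x * z) ≡⟨ solve 3 (λ x t y → t :* (x :* y) := x :* t :* y) refl x t z ⟩
  x * t * z   ≡⟨ cong (_* z) u ⟩
  1ℚ * z      ≡⟨ ℚₚ.*-identityˡ z ⟩
  z           ∎

*-cancelˡ : ∀ x y z → x ≢ 0ℚ → x * y ≡ x * z → y ≡ z
*-cancelˡ x y z x≢0 = cancel-unit x (proj₁ (inv x x≢0)) y z (proj₂ (inv x x≢0))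

x-y≡0⇒x≡y : ∀ x y → x - y ≡ 0ℚ → x ≡ y
x-y≡0⇒x≡y x y h = begin
  x           ≡⟨ solve 2 (λ x y → x := (x :- y) :+ y) refl x y ⟩
  (x - y) + y ≡⟨ cong (_+ y) h ⟩
  0ℚ + y      ≡⟨ ℚₚ.+-identityˡ y ⟩
  y           ∎

^-distribˡ-+ : ∀ x m n → x ^ℚ (m ℕ.+ n) ≡ (x ^ℚ m) * (x ^ℚ n)
^-distribˡ-+ x zero n = sym (ℚₚ.*-identityˡ (x ^ℚ n))
^-distribˡ-+ x (suc m) n = trans (cong (x *_) (^-distribˡ-+ x m n)) (sym (ℚₚ.*-assoc x (x ^ℚ m) (x ^ℚ n)))

*-^ : ∀ x y n → (x * y) ^ℚ n ≡ (x ^ℚ n) * (y ^ℚ n)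
*-^ x y zero = refl
*-^ x y (suc n) = trans (cong (x * y *_) (*-^ x y n))
  (solve 4 (λ x y u v → x :* y :* (u :* v) := x :* u :* (y :* v)) refl x y (x ^ℚ n) (y ^ℚ n))

1^ : ∀ n → 1ℚ ^ℚ n ≡ 1ℚ
1^ zero = refl
1^ (suc n) = trans (ℚₚ.*-identityˡ (1ℚ ^ℚ n)) (1^ n)

^-* : ∀ x m n → x ^ℚ (m ℕ.* n) ≡ (x ^ℚ m) ^ℚ n
^-* x zero n = sym (1^ n)
^-* x (suc m) n = begin
  x ^ℚ (n ℕ.+ m ℕ.* n)        ≡⟨ ^-distribˡ-+ x n (m ℕ.* n) ⟩
  (x ^ℚ n) * (x ^ℚ (m ℕ.* n)) ≡⟨ cong ((x ^ℚ n) *_) (^-* x m n) ⟩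
  (x ^ℚ n) * ((x ^ℚ m) ^ℚ n)  ≡⟨ sym (*-^ x (x ^ℚ m) n) ⟩
  (x * (x ^ℚ m)) ^ℚ n         ∎

-- Polynomial functions on ℚ

scale : ℚ → Poly → Poly
scale s = map (s *_)

ev-scale : ∀ s L x → ev (scale s L) x ≡ s * ev L x
ev-scale s [] x = sym (ℚₚ.*-zeroʳ s)
ev-scale s (a ∷ L) x = trans (cong (λ e → s * a + x * e) (ev-scale s L x))
  (solve 4 (λ s a x e → s :* a :+ x :* (s :* e) := s :* (a :+ x :* e)) refl s a x (ev L x))

ev-++ : ∀ L L′ x → ev (L ++ L′) x ≡ ev L x + (x ^ℚ length L) * ev L′ x
ev-++ [] L′ x = solve 1 (λ e → e := con 0ℚ :+ con 1ℚ :* e) refl (ev L′ x)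
ev-++ (a ∷ L) L′ x = trans (cong (λ e → a + x * e) (ev-++ L L′ x))
  (solve 5 (λ a x e k f → a :+ x :* (e :+ k :* f) := a :+ x :* e :+ x :* k :* f) refl a x (ev L x) (x ^ℚ length L) (ev L′ x))

_⊕_ : Poly → Poly → Poly
[]      ⊕ M       = M
(a ∷ L) ⊕ []      = a ∷ L
(a ∷ L) ⊕ (b ∷ M) = (a + b) ∷ (L ⊕ M)

ev-⊕ : ∀ L M x → ev (L ⊕ M) x ≡ ev L x + ev M x
ev-⊕ [] M x = sym (ℚₚ.+-identityˡ (ev M x))
ev-⊕ (a ∷ L) [] x = sym (ℚₚ.+-identityʳ (ev (a ∷ L) x))
ev-⊕ (a ∷ L) (b ∷ M) x = trans (cong (λ e → a + b + x * e) (ev-⊕ L M x))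
  (solve 5 (λ a b x e f → a :+ b :+ x :* (e :+ f) := a :+ x :* e :+ (b :+ x :* f)) refl a b x (ev L x) (ev M x))

-- Synthetic division of x L(x), not of L(x), by x − r.
quotient : ℚ → Poly → Poly
quotient r []       = []
quotient r (b ∷ bs) = ev (b ∷ bs) r ∷ quotient r bs

length-quotient : ∀ r L → length (quotient r L) ≡ length L
length-quotient r [] = refl
length-quotient r (b ∷ bs) = cong suc (length-quotient r bs)

ev-quotient : ∀ r L x → x * ev L x ≡ r * ev L r + (x - r) * ev (quotient r L) x
ev-quotient r [] x = solve 2 (λ x r → x :* con 0ℚ := r :* con 0ℚ :+ (x :- r) :* con 0ℚ) refl x r
ev-quotient r (b ∷ bs) x = begin
  x * (b + x * ev bs x)
    ≡⟨ cong (λ e → x * (b + e)) (ev-quotient r bs x) ⟩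
  x * (b + (r * ev bs r + (x - r) * ev (quotient r bs) x))
    ≡⟨ solve 5 (λ x r b e q → x :* (b :+ (r :* e :+ (x :- r) :* q))
          := r :* (b :+ r :* e) :+ (x :- r) :* ((b :+ r :* e) :+ x :* q)) refl x r b (ev bs r) (ev (quotient r bs) x) ⟩
  r * (b + r * ev bs r) + (x - r) * ((b + r * ev bs r) + x * ev (quotient r bs) x) ∎

ev-∷-quotient : ∀ r a L x → ev (a ∷ L) x ≡ ev (a ∷ L) r + (x - r) * ev (quotient r L) x
ev-∷-quotient r a L x = trans (cong (a +_) (ev-quotient r L x)) (sym (ℚₚ.+-assoc a (r * ev L r) ((x - r) * ev (quotient r L) x)))

ℕ→ℚ-injective : ∀ {m n} → ℕ→ℚ m ≡ ℕ→ℚ n → m ≡ n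
ℕ→ℚ-injective e = ℤₚ.+-injective (ι-injective e)

-- Each division by x - B uses up the root B, and n - B is nonzero for the later integers n, so the
-- quotient again vanishes from B + 1 on. The explicit length `k` is what decreases, as the quotient
-- is not a sublist of L.
vanishing : ∀ k L → length L ≡ k → ∀ B → (∀ n → B ≤ n → ev L (ℕ→ℚ n) ≡ 0ℚ) → ∀ x → ev L x ≡ 0ℚ
vanishing k [] _ B h x = refl
vanishing (suc k) (a ∷ L) len B h x = begin
  ev (a ∷ L) x                                       ≡⟨ ev-∷-quotient r a L x ⟩
  ev (a ∷ L) r + (x - r) * ev (quotient r L) x        ≡⟨ cong₂ (λ u v → u + (x - r) * v) (h B ℕₚ.≤-refl) quotient≡0 ⟩
  0ℚ + (x - r) * 0ℚ                                   ≡⟨ solve 1 (λ y → con 0ℚ :+ y :* con 0ℚ := con 0ℚ) refl (x - r) ⟩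
  0ℚ                                                  ∎
  where
  r = ℕ→ℚ B
  quotient≡0 : ev (quotient r L) x ≡ 0ℚ
  quotient≡0 = vanishing k (quotient r L) (trans (length-quotient r L) (ℕₚ.suc-injective len)) (suc B)
    (λ n B<n → *-cancelˡ (ℕ→ℚ n - r) (ev (quotient r L) (ℕ→ℚ n)) 0ℚ (λ e → ℕₚ.<⇒≢ B<n (sym (ℕ→ℚ-injective (x-y≡0⇒x≡y (ℕ→ℚ n) r e))))
      (begin
        (ℕ→ℚ n - r) * ev (quotient r L) (ℕ→ℚ n) ≡⟨ sym (ℚₚ.+-identityˡ ((ℕ→ℚ n - r) * ev (quotient r L) (ℕ→ℚ n))) ⟩
        0ℚ + (ℕ→ℚ n - r) * ev (quotient r L) (ℕ→ℚ n) ≡⟨ cong (_+ (ℕ→ℚ n - r) * ev (quotient r L) (ℕ→ℚ n)) (sym (h B ℕₚ.≤-refl)) ⟩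
        ev (a ∷ L) r + (ℕ→ℚ n - r) * ev (quotient r L) (ℕ→ℚ n) ≡⟨ sym (ev-∷-quotient r a L (ℕ→ℚ n)) ⟩
        ev (a ∷ L) (ℕ→ℚ n) ≡⟨ h n (ℕₚ.<⇒≤ B<n) ⟩
        0ℚ ≡⟨ sym (ℚₚ.*-zeroʳ (ℕ→ℚ n - r)) ⟩
        (ℕ→ℚ n - r) * 0ℚ ∎)) x

-- Agreement far out suffices, so an identity multiplied by x - r can be cancelled at the integers
-- beyond r and then holds at r as well.
ev-ext : ∀ L L′ B → (∀ n → B ≤ n → ev L (ℕ→ℚ n) ≡ ev L′ (ℕ→ℚ n)) → ∀ x → ev L x ≡ ev L′ x
ev-ext L L′ B h x = x-y≡0⇒x≡y (ev L x) (ev L′ x) (trans (sym (ev-diff x)) (vanishing _ (L ⊕ scale (- 1ℚ) L′) refl B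
    (λ n B≤n → trans (ev-diff (ℕ→ℚ n)) (trans (cong (_- ev L′ (ℕ→ℚ n)) (h n B≤n)) (ℚₚ.+-inverseʳ (ev L′ (ℕ→ℚ n))))) x))
  where
  ev-diff : ∀ x → ev (L ⊕ scale (- 1ℚ) L′) x ≡ ev L x - ev L′ x
  ev-diff x = trans (ev-⊕ L (scale (- 1ℚ) L′) x) (trans (cong (ev L x +_) (ev-scale (- 1ℚ) L′ x))
    (solve 2 (λ a b → a :+ con (- 1ℚ) :* b := a :- b) refl (ev L x) (ev L′ x)))

cancel-linear : ∀ r L L′ → (∀ x → (x - ℕ→ℚ r) * ev L x ≡ (x - ℕ→ℚ r) * ev L′ x) → ∀ x → ev L x ≡ ev L′ x
cancel-linear r L L′ h = ev-ext L L′ (suc r) (λ n r<n →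
  *-cancelˡ (ℕ→ℚ n - ℕ→ℚ r) (ev L (ℕ→ℚ n)) (ev L′ (ℕ→ℚ n)) (λ e → ℕₚ.<⇒≢ r<n (sym (ℕ→ℚ-injective (x-y≡0⇒x≡y (ℕ→ℚ n) (ℕ→ℚ r) e)))) (h (ℕ→ℚ n)))

cancel-X : ∀ L L′ → (∀ x → x * ev L x ≡ x * ev L′ x) → ∀ x → ev L x ≡ ev L′ x
cancel-X L L′ h = cancel-linear 0 L L′ (λ x → trans (cong (_* ev L x) (ℚₚ.+-identityʳ x)) (trans (h x) (cong (_* ev L′ x) (sym (ℚₚ.+-identityʳ x)))))

+-cancelˡ : ∀ a b c → a + b ≡ a + c → b ≡ c
+-cancelˡ a b c e = begin
  b           ≡⟨ solve 2 (λ a b → b := (a :+ b) :- a) refl a b ⟩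
  (a + b) - a ≡⟨ cong (_- a) e ⟩
  (a + c) - a ≡⟨ solve 2 (λ a b → (a :+ b) :- a := b) refl a c ⟩
  c           ∎

ev-0 : ∀ a L → ev (a ∷ L) 0ℚ ≡ a
ev-0 a L = solve 2 (λ a e → a :+ con 0ℚ :* e := a) refl a (ev L 0ℚ)

∷-injective-ev : ∀ a b L L′ → (∀ x → ev (a ∷ L) x ≡ ev (b ∷ L′) x) → a ≡ b × (∀ x → ev L x ≡ ev L′ x)
∷-injective-ev a b L L′ h = a≡b , cancel-X L L′ (λ x → +-cancelˡ a (x * ev L x) (x * ev L′ x) (trans (h x) (cong (_+ x * ev L′ x) (sym a≡b))))
  where a≡b = trans (sym (ev-0 a L)) (trans (h 0ℚ) (ev-0 b L′))

-- Two lists with the same values differ only in trailing zeros, which `𝒞 0ℚ` covers. This carries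
-- membership from a representing list back to the coefficients of a given one.
All-resp-ev : ∀ {𝒞 : ℚ → Set} → 𝒞 0ℚ → ∀ L {L′} → All 𝒞 L′ → (∀ x → ev L x ≡ ev L′ x) → All 𝒞 L
All-resp-ev 𝒞0 [] _ h = []
All-resp-ev {𝒞} 𝒞0 (a ∷ L) [] h = subst 𝒞 (sym (proj₁ inj)) 𝒞0 ∷ All-resp-ev 𝒞0 L [] (proj₂ inj)
  where inj = ∷-injective-ev a 0ℚ L [] (λ x → trans (h x) (sym (trans (ℚₚ.+-identityˡ (x * 0ℚ)) (ℚₚ.*-zeroʳ x))))
All-resp-ev {𝒞} 𝒞0 (a ∷ L) {b ∷ L′} (c ∷ cs) h = subst 𝒞 (sym (proj₁ inj)) c ∷ All-resp-ev 𝒞0 L cs (proj₂ inj)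
  where inj = ∷-injective-ev a b L L′ h

X^_·_ : ℕ → Poly → Poly
X^ zero  · L = L
X^ suc n · L = 0ℚ ∷ (X^ n · L)

ev-X^ : ∀ n L x → ev (X^ n · L) x ≡ (x ^ℚ n) * ev L x
ev-X^ zero L x = sym (ℚₚ.*-identityˡ (ev L x))
ev-X^ (suc n) L x = trans (ℚₚ.+-identityˡ (x * ev (X^ n · L) x))
  (trans (cong (x *_) (ev-X^ n L x)) (sym (ℚₚ.*-assoc x (x ^ℚ n) (ev L x))))

length-X^ : ∀ n L → length (X^ n · L) ≡ n ℕ.+ length L
length-X^ zero L = refl
length-X^ (suc n) L = cong suc (length-X^ n L)

-- Divisibility by x^e forces the first e coefficients of L to be zero. Unlike the given cofactor
-- `L₁`, which may be padded with zeros, `drop e L` has a known length.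
ev-drop : ∀ e L L₁ → (∀ x → ev L x ≡ (x ^ℚ e) * ev L₁ x) → ∀ x → ev L x ≡ (x ^ℚ e) * ev (drop e L) x
ev-drop zero L L₁ h x = sym (ℚₚ.*-identityˡ (ev L x))
ev-drop (suc e) [] L₁ h x = sym (ℚₚ.*-zeroʳ (x ^ℚ suc e))
ev-drop (suc e) (a ∷ L) L₁ h x = trans (cong₂ (λ u v → u + x * v) (proj₁ inj) (ev-drop e L L₁ h′ x))
   (solve 3 (λ x y z → con 0ℚ :+ x :* (y :* z) := x :* y :* z) refl x (x ^ℚ e) (ev (drop e L) x))
  where
  inj = ∷-injective-ev a 0ℚ L (X^ e · L₁) (λ x → trans (h x) (sym (ev-X^ (suc e) L₁ x)))
  h′ : ∀ x → ev L x ≡ (x ^ℚ e) * ev L₁ x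
  h′ x = trans (proj₂ inj x) (ev-X^ e L₁ x)

-- The binomial theorem

binomialSum : ℕ → ℕ → ℚ → ℚ
binomialSum n zero y = 0ℚ
binomialSum n (suc m) y = binomialSum n m y + ℕ→ℚ (n C m) * (y ^ℚ m)

ℕ→ℚ-+ : ∀ m n → ℕ→ℚ (m ℕ.+ n) ≡ ℕ→ℚ m + ℕ→ℚ n
ℕ→ℚ-+ m n = trans (cong ι (ℤₚ.pos-+ m n)) (ι-+ (ℤ.+ m) (ℤ.+ n))

-- The cut-off varies independently of n, so Pascal's rule can be summed by induction on m;
-- multiplication by y shifts indices, hence one term fewer in the last sum.
binomialSum-pascal : ∀ n m y → binomialSum (suc n) (suc m) y ≡ binomialSum n (suc m) y + y * binomialSum n m y
binomialSum-pascal n zero y = solve 2 (λ y i → i :+ con 1ℚ :* con 1ℚ := i :+ con 1ℚ :* con 1ℚ :+ y :* con 0ℚ) refl y 0ℚ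
binomialSum-pascal n (suc m) y = begin
  binomialSum (suc n) (suc m) y + ℕ→ℚ (suc n C suc m) * (y * (y ^ℚ m))
    ≡⟨ cong₂ (λ u v → u + v * (y * (y ^ℚ m))) (binomialSum-pascal n m y)
         (trans (cong ℕ→ℚ (sym (nCk+nC[k+1]≡[n+1]C[k+1] n m))) (ℕ→ℚ-+ (n C m) (n C suc m))) ⟩
  binomialSum n (suc m) y + y * binomialSum n m y + (ℕ→ℚ (n C m) + ℕ→ℚ (n C suc m)) * (y * (y ^ℚ m))
    ≡⟨ solve 6 (λ s t y a b w → s :+ y :* t :+ (a :+ b) :* (y :* w) := s :+ b :* (y :* w) :+ y :* (t :+ a :* w)) refl
         (binomialSum n (suc m) y) (binomialSum n m y) y (ℕ→ℚ (n C m)) (ℕ→ℚ (n C suc m)) (y ^ℚ m) ⟩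
  binomialSum n (suc m) y + ℕ→ℚ (n C suc m) * (y * (y ^ℚ m)) + y * (binomialSum n m y + ℕ→ℚ (n C m) * (y ^ℚ m)) ∎

binomial : ∀ n y → (1ℚ + y) ^ℚ n ≡ binomialSum n (suc n) y
binomial zero y = refl
binomial (suc n) y = begin
  (1ℚ + y) * ((1ℚ + y) ^ℚ n) ≡⟨ cong ((1ℚ + y) *_) (binomial n y) ⟩
  -- The extra zero term is the one of index n + 1, where the binomial coefficient of n vanishes; it
  -- brings the sum to the length that `binomialSum-pascal` expects.
  (1ℚ + y) * S ≡⟨ solve 3 (λ y s w → (con 1ℚ :+ y) :* s := s :+ con 0ℚ :* w :+ y :* s) refl y S (y ^ℚ suc n) ⟩
  S + 0ℚ * (y ^ℚ suc n) + y * S ≡⟨ cong (λ c → S + ℕ→ℚ c * (y ^ℚ suc n) + y * S) (sym (k>n⇒nCk≡0 (ℕₚ.n<1+n n))) ⟩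
  binomialSum n (suc (suc n)) y + y * S ≡⟨ sym (binomialSum-pascal n (suc n) y) ⟩
  binomialSum (suc n) (suc (suc n)) y ∎
  where S = binomialSum n (suc n) y

-- Iteration, and the passage from preperiodic to periodic points

iter-+ : ∀ {A : Set} (g : A → A) m n x → iter g (m ℕ.+ n) x ≡ iter g m (iter g n x)
iter-+ g zero n x = refl
iter-+ g (suc m) n x = cong g (iter-+ g m n x)

iter-* : ∀ {A : Set} (g : A → A) k {x} → iter g k x ≡ x → ∀ n → iter g (n ℕ.* k) x ≡ x
iter-* g k h zero = refl
iter-* g k {x} h (suc n) = trans (iter-+ g k (n ℕ.* k) x) (trans (cong (iter g k) (iter-* g k h n)) h)

iter-∞ : ∀ P Q n → iter (act P Q) n ∞ ≡ ∞
iter-∞ P Q zero = refl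
iter-∞ P Q (suc n) = cong (act P Q) (iter-∞ P Q n)

fin-injective : ∀ {x y} → fin x ≡ fin y → x ≡ y
fin-injective refl = refl

-- ∞ is fixed, so an orbit that meets it stays there, yet after n(j + 1) ≥ n steps it would be back
-- at the finite point x.
periodic-finite : ∀ P Q j {x} → iter (act P Q) (suc j) (fin x) ≡ fin x → ∀ n → ∃[ y ] (iter (act P Q) n (fin x) ≡ fin y)
periodic-finite P Q j {x} h n = go (iter g n (fin x)) refl
  where
  g = act P Q
  go : ∀ w → iter g n (fin x) ≡ w → ∃[ y ] (iter g n (fin x) ≡ fin y)
  go (fin y) e = y , e
  go ∞ e = ⊥-elim (fin≢∞ (begin
    fin x                                         ≡⟨ sym (iter-* g (suc j) h n) ⟩
    iter g (n ℕ.* suc j) (fin x)                  ≡⟨ cong (λ m → iter g m (fin x)) (trans (ℕₚ.*-suc n j) (ℕₚ.+-comm n (n ℕ.* j))) ⟩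
    iter g (n ℕ.* j ℕ.+ n) (fin x)                ≡⟨ iter-+ g (n ℕ.* j) n (fin x) ⟩
    iter g (n ℕ.* j) (iter g n (fin x))           ≡⟨ cong (iter g (n ℕ.* j)) e ⟩
    iter g (n ℕ.* j) ∞                            ≡⟨ iter-∞ P Q (n ℕ.* j) ⟩
    ∞                                             ∎))
    where
    fin≢∞ : fin x ≢ ∞
    fin≢∞ ()

act-fin : ∀ P Q {x x′} → act P Q (fin x) ≡ fin x′ → x′ * ev Q x ≡ ev P x
act-fin P Q {x} {x′} h with ev Q x ≟ 0ℚ
... | no q≢0 = begin
  x′ * ev Q x                                          ≡⟨ cong (_* ev Q x) (sym (fin-injective h)) ⟩
  ev P x * (1/ ev Q x) {{nz}} * ev Q x   ≡⟨ ℚₚ.*-assoc (ev P x) ((1/ ev Q x) {{nz}}) (ev Q x) ⟩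
  ev P x * ((1/ ev Q x) {{nz}} * ev Q x) ≡⟨ cong (ev P x *_) (ℚₚ.*-inverseˡ (ev Q x) {{nz}}) ⟩
  ev P x * 1ℚ                                          ≡⟨ ℚₚ.*-identityʳ (ev P x) ⟩
  ev P x                                               ∎
  where nz = ≢-nonZero q≢0

-- The n-th iterate is periodic with period m - n, written as a successor to match the hypothesis on
-- periodic points.
repeat⇒fixed : (g : ℙ¹ → ℙ¹) → (∀ j x → iter g (suc j) x ≡ x → g x ≡ x) →
  ∀ {n m} x → n ℕ.< m → iter g n x ≡ iter g m x → iter g n x ≡ iter g (suc n) x
repeat⇒fixed g fixed {n} {m} x n<m e = sym (fixed (m ℕ.∸ suc n) (iter g n x) (begin
    iter g (suc (m ℕ.∸ suc n)) (iter g n x)    ≡⟨ sym (iter-+ g (suc (m ℕ.∸ suc n)) n x) ⟩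
    iter g (suc (m ℕ.∸ suc n) ℕ.+ n) x         ≡⟨ cong (λ k → iter g k x) (trans (sym (ℕₚ.+-suc (m ℕ.∸ suc n) n)) (ℕₚ.m∸n+n≡m n<m)) ⟩
    iter g m x                                 ≡⟨ sym e ⟩
    iter g n x                                 ∎))

preperiodic⇒eventually-fixed : (g : ℙ¹ → ℙ¹) → (∀ j x → iter g (suc j) x ≡ x → g x ≡ x) →
  ∀ x → IsPreperiodic g x → ∃[ m ] (iter g m x ≡ iter g (suc m) x)
preperiodic⇒eventually-fixed g fixed x (n , m , n≢m , e) with ℕₚ.<-cmp n m
... | tri< n<m _ _ = n , repeat⇒fixed g fixed x n<m e
... | tri≈ _ n≡m _ = ⊥-elim (n≢m n≡m)
... | tri> _ _ m<n = m , repeat⇒fixed g fixed x m<n (sym e)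

module AtPrime (p : ℕ) (pp : Prime p) where

  -- The local ring 𝒪 = ℤ₍ₚ₎ and its maximal ideal 𝔪 = p𝒪

  p∤1 : p ∤ 1
  p∤1 h = ℕₚ.<⇒≱ (ℕ.nonTrivial⇒n>1 p {{prime⇒nonTrivial pp}}) (∣⇒≤ h)

  p∤* : ∀ a b → p ∤ ∣ a ∣ → p ∤ ∣ b ∣ → p ∤ ∣ a ℤ.* b ∣
  p∤* a b ha hb h with euclidsLemma ∣ a ∣ ∣ b ∣ pp (subst (p ∣_) (ℤₚ.abs-* a b) h)
  ... | inj₁ x = ha x
  ... | inj₂ x = hb x

  -- Any fraction with denominator prime to p is a witness, not only the reduced one, so sums and
  -- products need no cancellation.
  record 𝒪 (x : ℚ) : Set where
    constructor frac
    field
      den num : ℤ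
      p∤den   : p ∤ ∣ den ∣
      x*den   : x * ι den ≡ ι num

  record 𝔪 (x : ℚ) : Set where
    constructor mult
    field
      cofactor : ℚ
      integral : 𝒪 cofactor
      x≡       : x ≡ ℕ→ℚ p * cofactor

  𝒪-ι : ∀ n → 𝒪 (ι n)
  𝒪-ι n = frac (ℤ.+ 1) n p∤1 (ℚₚ.*-identityʳ (ι n))

  𝒪-+ : ∀ {x y} → 𝒪 x → 𝒪 y → 𝒪 (x + y)
  𝒪-+ {x} {y} (frac b a hb e) (frac b′ a′ hb′ e′) = frac (b ℤ.* b′) (a ℤ.* b′ ℤ.+ a′ ℤ.* b) (p∤* b b′ hb hb′) (begin
    (x + y) * ι (b ℤ.* b′)           ≡⟨ cong ((x + y) *_) (ι-* b b′) ⟩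
    (x + y) * (ι b * ι b′)           ≡⟨ solve 4 (λ x y b b′ → (x :+ y) :* (b :* b′) := x :* b :* b′ :+ y :* b′ :* b) refl x y (ι b) (ι b′) ⟩
    x * ι b * ι b′ + y * ι b′ * ι b  ≡⟨ cong₂ (λ u v → u * ι b′ + v * ι b) e e′ ⟩
    ι a * ι b′ + ι a′ * ι b          ≡⟨ sym (cong₂ _+_ (ι-* a b′) (ι-* a′ b)) ⟩
    ι (a ℤ.* b′) + ι (a′ ℤ.* b)      ≡⟨ sym (ι-+ (a ℤ.* b′) (a′ ℤ.* b)) ⟩
    ι (a ℤ.* b′ ℤ.+ a′ ℤ.* b)        ∎)

  𝒪-* : ∀ {x y} → 𝒪 x → 𝒪 y → 𝒪 (x * y)
  𝒪-* {x} {y} (frac b a hb e) (frac b′ a′ hb′ e′) = frac (b ℤ.* b′) (a ℤ.* a′) (p∤* b b′ hb hb′) (begin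
    x * y * ι (b ℤ.* b′)       ≡⟨ cong (x * y *_) (ι-* b b′) ⟩
    x * y * (ι b * ι b′)       ≡⟨ solve 4 (λ x y b b′ → x :* y :* (b :* b′) := x :* b :* (y :* b′)) refl x y (ι b) (ι b′) ⟩
    x * ι b * (y * ι b′)       ≡⟨ cong₂ _*_ e e′ ⟩
    ι a * ι a′                 ≡⟨ sym (ι-* a a′) ⟩
    ι (a ℤ.* a′)               ∎)

  𝒪-0 : 𝒪 0ℚ
  𝒪-0 = 𝒪-ι (ℤ.+ 0)

  𝒪-1 : 𝒪 1ℚ
  𝒪-1 = 𝒪-ι (ℤ.+ 1)

  𝒪-neg : ∀ {x} → 𝒪 x → 𝒪 (- x)
  𝒪-neg {x} h = subst 𝒪 (solve 1 (λ x → con (- 1ℚ) :* x := :- x) refl x) (𝒪-* (𝒪-ι (ℤ.- (ℤ.+ 1))) h)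

  𝒪-^ : ∀ {x} n → 𝒪 x → 𝒪 (x ^ℚ n)
  𝒪-^ zero h = 𝒪-1
  𝒪-^ (suc n) h = 𝒪-* h (𝒪-^ n h)

  𝔪-0 : 𝔪 0ℚ
  𝔪-0 = mult 0ℚ 𝒪-0 (sym (ℚₚ.*-zeroʳ (ℕ→ℚ p)))

  𝔪-+ : ∀ {x y} → 𝔪 x → 𝔪 y → 𝔪 (x + y)
  𝔪-+ (mult c hc e) (mult c′ hc′ e′) = mult (c + c′) (𝒪-+ hc hc′)
    (trans (cong₂ _+_ e e′) (sym (ℚₚ.*-distribˡ-+ (ℕ→ℚ p) c c′)))

  𝔪-*ˡ : ∀ {x y} → 𝒪 x → 𝔪 y → 𝔪 (x * y)
  𝔪-*ˡ {x} hx (mult c hc e) = mult (x * c) (𝒪-* hx hc)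
    (trans (cong (x *_) e) (solve 3 (λ x q c → x :* (q :* c) := q :* (x :* c)) refl x (ℕ→ℚ p) c))

  𝔪-*ʳ : ∀ {x y} → 𝔪 x → 𝒪 y → 𝔪 (x * y)
  𝔪-*ʳ {x} {y} hx hy = subst 𝔪 (ℚₚ.*-comm y x) (𝔪-*ˡ hy hx)

  𝔪⇒𝒪 : ∀ {x} → 𝔪 x → 𝒪 x
  𝔪⇒𝒪 (mult c hc e) = subst 𝒪 (sym e) (𝒪-* (𝒪-ι (ℤ.+ p)) hc)

  𝔪-neg : ∀ {x} → 𝔪 x → 𝔪 (- x)
  𝔪-neg {x} h = subst 𝔪 (solve 1 (λ x → con (- 1ℚ) :* x := :- x) refl x) (𝔪-*ˡ (𝒪-ι (ℤ.- (ℤ.+ 1))) h)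

  𝔪-- : ∀ {x y} → 𝔪 x → 𝔪 y → 𝔪 (x - y)
  𝔪-- hx hy = 𝔪-+ hx (𝔪-neg hy)

  𝔪-swap : ∀ x y → 𝔪 (x - y) → 𝔪 (y - x)
  𝔪-swap x y h = subst 𝔪 (solve 2 (λ x y → :- (x :- y) := y :- x) refl x y) (𝔪-neg h)

  𝔪-trans : ∀ x y z → 𝔪 (x - y) → 𝔪 (y - z) → 𝔪 (x - z)
  𝔪-trans x y z h k = subst 𝔪 (solve 3 (λ x y z → (x :- y) :+ (y :- z) := x :- z) refl x y z) (𝔪-+ h k)

  ∣⇒𝔪 : ∀ a → p ∣ ∣ a ∣ → 𝔪 (ι a)
  ∣⇒𝔪 a h with ℤₛ.∣ᵤ⇒∣ {ℤ.+ p} {a} h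
  ... | ℤₛ.divides q e = mult (ι q) (𝒪-ι q) (trans (cong ι (trans e (ℤₚ.*-comm q (ℤ.+ p)))) (ι-* (ℤ.+ p) q))

  -- Writing ι a = pn/b with p ∤ b gives ab = pn, and p must divide a because it does not divide b.
  -- Thus 𝔪 meets ℤ in pℤ.
  𝔪⇒∣ : ∀ a → 𝔪 (ι a) → p ∣ ∣ a ∣
  𝔪⇒∣ a (mult c (frac b n hb e) e′) with euclidsLemma ∣ a ∣ ∣ b ∣ pp (subst (p ∣_) (trans (cong ∣_∣ (sym eq)) (ℤₚ.abs-* a b))
        (subst (p ∣_) (sym (ℤₚ.abs-* (ℤ.+ p) n)) (m∣m*n ∣ n ∣)))
    where
    eq : a ℤ.* b ≡ ℤ.+ p ℤ.* n
    eq = ι-injective (begin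
      ι (a ℤ.* b)        ≡⟨ ι-* a b ⟩
      ι a * ι b          ≡⟨ cong (_* ι b) e′ ⟩
      ℕ→ℚ p * c * ι b     ≡⟨ ℚₚ.*-assoc (ℕ→ℚ p) c (ι b) ⟩
      ℕ→ℚ p * (c * ι b)   ≡⟨ cong (ℕ→ℚ p *_) e ⟩
      ℕ→ℚ p * ι n         ≡⟨ sym (ι-* (ℤ.+ p) n) ⟩
      ι (ℤ.+ p ℤ.* n)    ∎)
  ... | inj₁ x = x
  ... | inj₂ x = ⊥-elim (hb x)

  ¬𝔪-1 : ¬ 𝔪 1ℚ
  ¬𝔪-1 h = p∤1 (𝔪⇒∣ (ℤ.+ 1) h)

  p∤⇒≢0 : ∀ b → p ∤ ∣ b ∣ → ι b ≢ 0ℚ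
  p∤⇒≢0 b h e = h (𝔪⇒∣ b (subst 𝔪 (sym e) 𝔪-0))

  fraction : ∀ a b → p ∤ ∣ b ∣ → ∃[ y ] (𝒪 y × y * ι b ≡ ι a)
  fraction a b h = ι a * t , frac b a h eq , eq
    where
    t = proj₁ (inv (ι b) (p∤⇒≢0 b h))
    eq : ι a * t * ι b ≡ ι a
    eq = trans (solve 3 (λ a t b → a :* t :* b := a :* (b :* t)) refl (ι a) t (ι b))
           (trans (cong (ι a *_) (proj₂ (inv (ι b) (p∤⇒≢0 b h)))) (ℚₚ.*-identityʳ (ι a)))

  record Unit (x : ℚ) : Set where
    constructor unit
    field
      inverse     : ℚ
      𝒪-inverse   : 𝒪 inverse
      x*inverse≡1 : x * inverse ≡ 1ℚ

  *-cancelʳ : ∀ x y z → z ≢ 0ℚ → x * z ≡ y * z → x ≡ y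
  *-cancelʳ x y z z≢0 e = *-cancelˡ z x y z≢0 (trans (ℚₚ.*-comm z x) (trans e (ℚₚ.*-comm y z)))

  -- 𝒪 is local: if p does not divide the numerator a of x = a/b, then b/a is again p-integral.
  𝔪-or-unit : ∀ {x} → 𝒪 x → 𝔪 x ⊎ Unit x
  𝔪-or-unit {x} (frac b a hb e) with p ∣? ∣ a ∣
  ... | yes h = inj₁ (subst 𝔪 eq (𝔪-*ʳ (∣⇒𝔪 a h) (proj₁ (proj₂ 1/b))))
    where
    1/b = fraction (ℤ.+ 1) b hb
    t = proj₁ 1/b
    eq : ι a * t ≡ x
    eq = begin
      ι a * t       ≡⟨ cong (_* t) (sym e) ⟩
      x * ι b * t   ≡⟨ solve 3 (λ x b t → x :* b :* t := x :* (t :* b)) refl x (ι b) t ⟩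
      x * (t * ι b) ≡⟨ cong (x *_) (proj₂ (proj₂ 1/b)) ⟩
      x * 1ℚ        ≡⟨ ℚₚ.*-identityʳ x ⟩
      x             ∎
  ... | no h = inj₂ (unit u (proj₁ (proj₂ b/a)) (*-cancelʳ (x * u) 1ℚ (ι b) (p∤⇒≢0 b hb) (begin
      x * u * ι b   ≡⟨ solve 3 (λ x b u → x :* u :* b := u :* (x :* b)) refl x (ι b) u ⟩
      u * (x * ι b) ≡⟨ cong (u *_) e ⟩
      u * ι a       ≡⟨ proj₂ (proj₂ b/a) ⟩
      ι b           ≡⟨ sym (ℚₚ.*-identityˡ (ι b)) ⟩
      1ℚ * ι b      ∎)))
    where
    b/a = fraction b a h
    u = proj₁ b/a

  1+𝔪-unit : ∀ {x} → 𝔪 x → Unit (1ℚ + x)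
  1+𝔪-unit {x} h = [ (λ k → ⊥-elim (¬𝔪-1 (subst 𝔪 (solve 1 (λ x → con 1ℚ :+ x :- x := con 1ℚ) refl x) (𝔪-- k h)))) , id ]′
    (𝔪-or-unit (𝒪-+ 𝒪-1 (𝔪⇒𝒪 h)))

  𝔪-cancel-unit : ∀ {x} y → Unit x → 𝔪 (x * y) → 𝔪 y
  𝔪-cancel-unit {x} y (unit u 𝒪u xu≡1) h = subst 𝔪 (begin
      u * (x * y) ≡⟨ solve 3 (λ x y u → u :* (x :* y) := x :* u :* y) refl x y u ⟩
      x * u * y   ≡⟨ cong (_* y) xu≡1 ⟩
      1ℚ * y      ≡⟨ ℚₚ.*-identityˡ y ⟩
      y           ∎) (𝔪-*ˡ 𝒪u h)

  𝔪-prime : ∀ {x} y → 𝒪 x → 𝔪 (x * y) → 𝔪 x ⊎ 𝔪 y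
  𝔪-prime y hx h = Sum.map₂ (λ u → 𝔪-cancel-unit y u h) (𝔪-or-unit hx)

  p∣den⇒p∤num : ∀ x → p ∣ ∣ ↧ x ∣ → p ∤ ∣ ↥ x ∣
  p∣den⇒p∤num (ℚ.mkℚ n d-1 c) h k =
    ℕₚ.<⇒≢ (ℕ.nonTrivial⇒n>1 p {{prime⇒nonTrivial pp}}) (sym (Coprimality.recompute c (k , h)))

  -- 𝒪 is a valuation ring: in a reduced fraction p cannot divide both terms, so p in the
  -- denominator makes the reciprocal a multiple of p.
  𝒪-or-inverse-𝔪 : ∀ x → 𝒪 x ⊎ (∃[ t ] (𝔪 t × x * t ≡ 1ℚ))
  𝒪-or-inverse-𝔪 x with p ∣? ∣ ↧ x ∣
  ... | no h = inj₁ (frac (↧ x) (↥ x) h (ι-num-den x))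
  ... | yes h = inj₂ (t , 𝔪t , *-cancelʳ (x * t) 1ℚ (ι (↥ x)) (p∤⇒≢0 (↥ x) (p∣den⇒p∤num x h)) (begin
      x * t * ι (↥ x)   ≡⟨ ℚₚ.*-assoc x t (ι (↥ x)) ⟩
      x * (t * ι (↥ x)) ≡⟨ cong (x *_) tn≡d ⟩
      x * ι (↧ x)       ≡⟨ ι-num-den x ⟩
      ι (↥ x)           ≡⟨ sym (ℚₚ.*-identityˡ (ι (↥ x))) ⟩
      1ℚ * ι (↥ x)      ∎))
    where
    1/x = fraction (↧ x) (↥ x) (p∣den⇒p∤num x h)
    t = proj₁ 1/x
    tn≡d = proj₂ (proj₂ 1/x)
    𝔪t : 𝔪 t
    𝔪t = [ id , (λ k → ⊥-elim (p∣den⇒p∤num x h (𝔪⇒∣ (↥ x) k))) ]′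
      (𝔪-prime (ι (↥ x)) (proj₁ (proj₂ 1/x)) (subst 𝔪 (sym tn≡d) (∣⇒𝔪 (↧ x) h)))

  -- Functions on ℚ given by polynomials with coefficients in an 𝒪-submodule

  -- The instances are 𝒪 and 𝔪, so that integrality and divisibility by p share one set of closure
  -- lemmas.
  record Submodule (𝒞 : ℚ → Set) : Set where
    field
      0∈ : 𝒞 0ℚ
      +∈ : ∀ {x y} → 𝒞 x → 𝒞 y → 𝒞 (x + y)
      ∙∈ : ∀ {a x} → 𝒪 a → 𝒞 x → 𝒞 (a * x)

  open Submodule

  𝒪-submodule : Submodule 𝒪
  𝒪-submodule = record { 0∈ = 𝒪-0 ; +∈ = 𝒪-+ ; ∙∈ = 𝒪-* }

  𝔪-submodule : Submodule 𝔪
  𝔪-submodule = record { 0∈ = 𝔪-0 ; +∈ = 𝔪-+ ; ∙∈ = 𝔪-*ˡ }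

  -- Congruence of two polynomials modulo p is `Rep 𝔪` of their difference, a condition on
  -- coefficients. Values alone would not do: x^p - x takes values in 𝔪 on all of 𝒪.
  record Rep (𝒞 : ℚ → Set) (f : ℚ → ℚ) : Set where
    constructor rep
    field
      poly   : Poly
      coeffs : All 𝒞 poly
      f≡ev   : ∀ x → f x ≡ ev poly x

  open Rep

  Rep-resp : ∀ {𝒞 f g} → (∀ x → f x ≡ g x) → Rep 𝒞 f → Rep 𝒞 g
  Rep-resp h (rep L c e) = rep L c (λ x → trans (sym (h x)) (e x))

  Rep-ev : ∀ {𝒞} L → All 𝒞 L → Rep 𝒞 (ev L)
  Rep-ev L c = rep L c (λ _ → refl)

  Rep-const : ∀ {𝒞 c} → 𝒞 c → Rep 𝒞 (λ _ → c)
  Rep-const {𝒞} {c} h = rep (c ∷ []) (h ∷ []) (λ x → solve 2 (λ c x → c := c :+ x :* con 0ℚ) refl c x)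

  Rep-X* : ∀ {𝒞 f} → Submodule 𝒞 → Rep 𝒞 f → Rep 𝒞 (λ x → x * f x)
  Rep-X* S (rep L c e) = rep (0ℚ ∷ L) (0∈ S ∷ c) (λ x → trans (cong (x *_) (e x)) (sym (ℚₚ.+-identityˡ (x * ev L x))))

  All-⊕ : ∀ {𝒞 L M} → Submodule 𝒞 → All 𝒞 L → All 𝒞 M → All 𝒞 (L ⊕ M)
  All-⊕ S [] d = d
  All-⊕ S (c ∷ cs) [] = c ∷ cs
  All-⊕ S (c ∷ cs) (d ∷ ds) = +∈ S c d ∷ All-⊕ S cs ds

  All-scale : ∀ {𝒞 L s} → Submodule 𝒞 → 𝒪 s → All 𝒞 L → All 𝒞 (scale s L)
  All-scale S hs [] = []
  All-scale S hs (c ∷ cs) = ∙∈ S hs c ∷ All-scale S hs cs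

  Rep-+ : ∀ {𝒞 f g} → Submodule 𝒞 → Rep 𝒞 f → Rep 𝒞 g → Rep 𝒞 (λ x → f x + g x)
  Rep-+ S (rep L c e) (rep M d k) = rep (L ⊕ M) (All-⊕ S c d) (λ x → trans (cong₂ _+_ (e x) (k x)) (sym (ev-⊕ L M x)))

  Rep-scale : ∀ {𝒞 f s} → Submodule 𝒞 → 𝒪 s → Rep 𝒞 f → Rep 𝒞 (λ x → s * f x)
  Rep-scale {s = s} S hs (rep L c e) = rep (scale s L) (All-scale S hs c) (λ x → trans (cong (s *_) (e x)) (sym (ev-scale s L x)))

  Rep-- : ∀ {𝒞 f g} → Submodule 𝒞 → Rep 𝒞 f → Rep 𝒞 g → Rep 𝒞 (λ x → f x - g x)
  Rep-- {𝒞} {f} {g} S F G = Rep-resp (λ x → solve 2 (λ a b → a :+ con (- 1ℚ) :* b := a :- b) refl (f x) (g x))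
    (Rep-+ S F (Rep-scale S (𝒪-neg 𝒪-1) G))

  Rep-ev* : ∀ {𝒞 g} → Submodule 𝒞 → ∀ L → All 𝒪 L → Rep 𝒞 g → Rep 𝒞 (λ x → ev L x * g x)
  Rep-ev* {𝒞} {g} S [] [] G = Rep-resp (λ x → sym (ℚₚ.*-zeroˡ (g x))) (Rep-const (0∈ S))
  Rep-ev* {𝒞} {g} S (a ∷ L) (c ∷ cs) G =
    Rep-resp (λ x → solve 4 (λ a x e g → a :* g :+ x :* (e :* g) := (a :+ x :* e) :* g) refl a x (ev L x) (g x))
      (Rep-+ S (Rep-scale S c G) (Rep-X* S (Rep-ev* S L cs G)))

  Rep-* : ∀ {𝒞 f g} → Submodule 𝒞 → Rep 𝒪 f → Rep 𝒞 g → Rep 𝒞 (λ x → f x * g x)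
  Rep-* {𝒞} {f} {g} S (rep L c e) G = Rep-resp (λ x → cong (_* g x) (sym (e x))) (Rep-ev* S L c G)

  Rep-X : Rep 𝒪 (λ x → x)
  Rep-X = rep (0ℚ ∷ 1ℚ ∷ []) (𝒪-0 ∷ 𝒪-1 ∷ []) (λ x → solve 1 (λ x → x := con 0ℚ :+ x :* (con 1ℚ :+ x :* con 0ℚ)) refl x)

  Rep-^ : ∀ {f} n → Rep 𝒪 f → Rep 𝒪 (λ x → f x ^ℚ n)
  Rep-^ zero F = Rep-const 𝒪-1
  Rep-^ (suc n) F = Rep-* 𝒪-submodule F (Rep-^ n F)

  Rep-∘ev : ∀ {𝒞 g} → Submodule 𝒞 → ∀ L → All 𝒞 L → Rep 𝒪 g → Rep 𝒞 (λ x → ev L (g x))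
  Rep-∘ev S [] [] G = Rep-const (0∈ S)
  Rep-∘ev S (a ∷ L) (c ∷ cs) G = Rep-+ S (Rep-const c) (Rep-* S G (Rep-∘ev S L cs G))

  Rep-∘ : ∀ {𝒞 f g} → Submodule 𝒞 → Rep 𝒞 f → Rep 𝒪 g → Rep 𝒞 (λ x → f (g x))
  Rep-∘ {g = g} S (rep L c e) G = Rep-resp (λ x → sym (e (g x))) (Rep-∘ev S L c G)

  ev∈ : ∀ {𝒞 x} → Submodule 𝒞 → ∀ L → All 𝒞 L → 𝒪 x → 𝒞 (ev L x)
  ev∈ S [] [] hx = 0∈ S
  ev∈ S (a ∷ L) (c ∷ cs) hx = +∈ S c (∙∈ S hx (ev∈ S L cs hx))

  Rep-value : ∀ {𝒞 f x} → Submodule 𝒞 → Rep 𝒞 f → 𝒪 x → 𝒞 (f x)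
  Rep-value {𝒞} {f} {x} S (rep L c e) hx = subst 𝒞 (sym (e x)) (ev∈ S L c hx)

  All-quotient : ∀ {𝒞 r} → Submodule 𝒞 → 𝒪 r → ∀ L → All 𝒞 L → All 𝒞 (quotient r L)
  All-quotient S hr [] [] = []
  All-quotient S hr (a ∷ L) (c ∷ cs) = ev∈ S (a ∷ L) (c ∷ cs) hr ∷ All-quotient S hr L cs

  Rep-𝔪-^-cong : ∀ {f g} n → Rep 𝒪 f → Rep 𝒪 g → Rep 𝔪 (λ x → f x - g x) → Rep 𝔪 (λ x → (f x ^ℚ n) - (g x ^ℚ n))
  Rep-𝔪-^-cong zero F G H = Rep-resp (λ x → sym (ℚₚ.+-inverseʳ 1ℚ)) (Rep-const 𝔪-0)
  Rep-𝔪-^-cong {f} {g} (suc n) F G H = Rep-resp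
    (λ x → solve 4 (λ f g u v → f :* (u :- v) :+ v :* (f :- g) := f :* u :- g :* v) refl (f x) (g x) (f x ^ℚ n) (g x ^ℚ n))
    (Rep-+ 𝔪-submodule (Rep-* 𝔪-submodule F (Rep-𝔪-^-cong n F G H)) (Rep-* 𝔪-submodule (Rep-^ n G) H))

  -- The Frobenius congruence

  -- Subtracting 1 removes the term of index 0; every other index k satisfies 0 < k < p, so p
  -- divides its coefficient.
  binomialSum-middle : ∀ m → m ℕ.< p → Rep 𝔪 (λ y → binomialSum p (suc m) y - 1ℚ)
  binomialSum-middle zero h = Rep-resp (λ y → refl) (Rep-const 𝔪-0)
  binomialSum-middle (suc m) h = Rep-resp
    (λ y → solve 3 (λ a b c → (a :- c) :+ b := a :+ b :- c) refl (binomialSum p (suc m) y) (ℕ→ℚ (p C suc m) * (y ^ℚ suc m)) 1ℚ)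
    (Rep-+ 𝔪-submodule (binomialSum-middle m (ℕₚ.<⇒≤ h))
      (Rep-resp (λ y → ℚₚ.*-comm (y ^ℚ suc m) (ℕ→ℚ (p C suc m))) (Rep-* 𝔪-submodule (Rep-^ (suc m) Rep-X) (Rep-const (∣⇒𝔪 (ℤ.+ (p C suc m)) (prime∣C pp (s≤s z≤n) h))))))

  freshman : Rep 𝔪 (λ y → ((1ℚ + y) ^ℚ p) - (1ℚ + (y ^ℚ p)))
  freshman = go p refl (prime⇒nonZero pp)
    where
    -- Here p is exposed as n + 1: the terms of index at most n fall under `binomialSum-middle`, and
    -- the last one is y^p.
    go : ∀ n → n ≡ p → ℕ.NonZero n → Rep 𝔪 (λ y → ((1ℚ + y) ^ℚ p) - (1ℚ + (y ^ℚ p)))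
    go (suc n) refl _ = Rep-resp (λ y → sym (eq y)) (binomialSum-middle n (ℕₚ.n<1+n n))
      where
      eq : ∀ y → ((1ℚ + y) ^ℚ p) - (1ℚ + (y ^ℚ p)) ≡ binomialSum p p y - 1ℚ
      eq y = begin
        ((1ℚ + y) ^ℚ p) - (1ℚ + (y ^ℚ p)) ≡⟨ cong (_- (1ℚ + (y ^ℚ p))) (binomial p y) ⟩
        binomialSum p p y + ℕ→ℚ (p C p) * (y ^ℚ p) - (1ℚ + (y ^ℚ p)) ≡⟨ cong (λ c → binomialSum p p y + ℕ→ℚ c * (y ^ℚ p) - (1ℚ + (y ^ℚ p))) (nCn≡1 p) ⟩
        binomialSum p p y + 1ℚ * (y ^ℚ p) - (1ℚ + (y ^ℚ p)) ≡⟨ solve 2 (λ s t → s :+ con 1ℚ :* t :- (con 1ℚ :+ t) := s :- con 1ℚ) refl (binomialSum p p y) (y ^ℚ p) ⟩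
        binomialSum p p y - 1ℚ ∎

  -- Put q = p^ℓ and f = x^q - 1. Then x^(pq) = (1 + f)^p ≡ 1 + f^p by `freshman`, and f ≡ (x - 1)^q
  -- by induction, which is then raised to the power p.
  frobenius-iterate : ∀ ℓ → Rep 𝔪 (λ x → (x ^ℚ (p ^ ℓ)) - 1ℚ - ((x - 1ℚ) ^ℚ (p ^ ℓ)))
  frobenius-iterate zero = Rep-resp (λ x → solve 1 (λ x → con 0ℚ := x :* con 1ℚ :- con 1ℚ :- (x :- con 1ℚ) :* con 1ℚ) refl x) (Rep-const 𝔪-0)
  frobenius-iterate (suc ℓ) = Rep-resp eq
    (Rep-+ 𝔪-submodule (Rep-∘ 𝔪-submodule freshman F) (Rep-𝔪-^-cong p F G (frobenius-iterate ℓ)))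
    where
    q = p ^ ℓ
    f g : ℚ → ℚ
    f x = (x ^ℚ q) - 1ℚ
    g x = (x - 1ℚ) ^ℚ q
    F : Rep 𝒪 f
    F = Rep-- 𝒪-submodule (Rep-^ q Rep-X) (Rep-const 𝒪-1)
    G : Rep 𝒪 g
    G = Rep-^ q (Rep-- 𝒪-submodule Rep-X (Rep-const 𝒪-1))
    power : ∀ x → x ^ℚ (p ℕ.* q) ≡ (x ^ℚ q) ^ℚ p
    power x = trans (cong (x ^ℚ_) (ℕₚ.*-comm p q)) (^-* x q p)
    eq : ∀ x → ((1ℚ + f x) ^ℚ p) - (1ℚ + (f x ^ℚ p)) + ((f x ^ℚ p) - (g x ^ℚ p))
             ≡ (x ^ℚ (p ℕ.* q)) - 1ℚ - ((x - 1ℚ) ^ℚ (p ℕ.* q))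
    eq x = begin
      ((1ℚ + f x) ^ℚ p) - (1ℚ + (f x ^ℚ p)) + ((f x ^ℚ p) - (g x ^ℚ p))
        ≡⟨ solve 3 (λ a b c → a :- (con 1ℚ :+ b) :+ (b :- c) := a :- con 1ℚ :- c) refl ((1ℚ + f x) ^ℚ p) (f x ^ℚ p) (g x ^ℚ p) ⟩
      ((1ℚ + f x) ^ℚ p) - 1ℚ - (g x ^ℚ p)
        ≡⟨ cong₂ (λ u v → u - 1ℚ - v)
             (trans (cong (_^ℚ p) (solve 1 (λ u → con 1ℚ :+ (u :- con 1ℚ) := u) refl (x ^ℚ q))) (sym (power x)))
             (sym (power (x - 1ℚ))) ⟩
      (x ^ℚ (p ℕ.* q)) - 1ℚ - ((x - 1ℚ) ^ℚ (p ℕ.* q)) ∎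

  -- With q = p^ℓ, the witness `Z` is the geometric sum 1 + x^q + ... + x^((n-1)q), the quotient of
  -- x^(nq) - 1 by x^q - 1; the divisor is congruent to (x - 1)^q.
  X^[n*p^ℓ]-1 : ∀ n ℓ → Σ (ℚ → ℚ) λ Z → Rep 𝒪 Z × Rep 𝔪 (λ x → (x ^ℚ (n ℕ.* p ^ ℓ)) - 1ℚ - ((x - 1ℚ) ^ℚ (p ^ ℓ)) * Z x)
  X^[n*p^ℓ]-1 zero ℓ = (λ _ → 0ℚ) , Rep-const 𝒪-0 ,
    Rep-resp (λ x → solve 1 (λ g → con 0ℚ := con 1ℚ :- con 1ℚ :- g :* con 0ℚ) refl ((x - 1ℚ) ^ℚ (p ^ ℓ))) (Rep-const 𝔪-0)
  X^[n*p^ℓ]-1 (suc n) ℓ = (λ x → 1ℚ + (x ^ℚ q) * Z x) ,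
    Rep-+ 𝒪-submodule (Rep-const 𝒪-1) (Rep-* 𝒪-submodule (Rep-^ q Rep-X) (proj₁ (proj₂ IH))) ,
    Rep-resp (λ x → trans
      (solve 4 (λ A B g z → A :* (B :- con 1ℚ :- g :* z) :+ (A :- con 1ℚ :- g) := A :* B :- con 1ℚ :- g :* (con 1ℚ :+ A :* z)) refl
         (x ^ℚ q) (x ^ℚ (n ℕ.* q)) ((x - 1ℚ) ^ℚ q) (Z x))
      (cong (λ u → u - 1ℚ - ((x - 1ℚ) ^ℚ q) * (1ℚ + (x ^ℚ q) * Z x)) (sym (^-distribˡ-+ x q (n ℕ.* q)))))
      (Rep-+ 𝔪-submodule (Rep-* 𝔪-submodule (Rep-^ q Rep-X) (proj₂ (proj₂ IH))) (frobenius-iterate ℓ))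
    where
    q = p ^ ℓ
    IH = X^[n*p^ℓ]-1 n ℓ
    Z = proj₁ IH

  -- Division by x - 1 over 𝒪 and the Padé congruences

  tail-quotient : ℚ → Poly → Poly
  tail-quotient r L = quotient r (drop 1 L)

  -- `quotient` divides x times its argument, and L is its constant coefficient plus x times its
  -- tail; the constant only enters the remainder.
  ev-tail-quotient : ∀ r L x → ev L x ≡ ev L r + (x - r) * ev (tail-quotient r L) x
  ev-tail-quotient r [] x = solve 1 (λ y → con 0ℚ := con 0ℚ :+ y :* con 0ℚ) refl (x - r)
  ev-tail-quotient r (a ∷ L) x = ev-∷-quotient r a L x

  All-tail-quotient : ∀ {𝒞 r} → Submodule 𝒞 → 𝒪 r → ∀ L → All 𝒞 L → All 𝒞 (tail-quotient r L)
  All-tail-quotient S hr [] [] = []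
  All-tail-quotient S hr (a ∷ L) (c ∷ cs) = All-quotient S hr L cs

  -- Cancellation of x - 1 compares coefficient lists, so the product (x - 1)^k L has to exist as a
  -- list and not only as a function.
  [X-1]^_·_ : ℕ → Poly → Poly
  [X-1]^ zero  · L = L
  [X-1]^ suc k · L = (0ℚ ∷ ([X-1]^ k · L)) ⊕ scale (- 1ℚ) ([X-1]^ k · L)

  ev-[X-1]^ : ∀ k L x → ev ([X-1]^ k · L) x ≡ ((x - 1ℚ) ^ℚ k) * ev L x
  ev-[X-1]^ zero L x = sym (ℚₚ.*-identityˡ (ev L x))
  ev-[X-1]^ (suc k) L x = begin
    ev ((0ℚ ∷ K) ⊕ scale (- 1ℚ) K) x                ≡⟨ ev-⊕ (0ℚ ∷ K) (scale (- 1ℚ) K) x ⟩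
    0ℚ + x * ev K x + ev (scale (- 1ℚ) K) x         ≡⟨ cong (0ℚ + x * ev K x +_) (ev-scale (- 1ℚ) K x) ⟩
    0ℚ + x * ev K x + - 1ℚ * ev K x                 ≡⟨ solve 2 (λ x e → con 0ℚ :+ x :* e :+ con (- 1ℚ) :* e := (x :- con 1ℚ) :* e) refl x (ev K x) ⟩
    (x - 1ℚ) * ev K x                               ≡⟨ cong ((x - 1ℚ) *_) (ev-[X-1]^ k L x) ⟩
    (x - 1ℚ) * (((x - 1ℚ) ^ℚ k) * ev L x)           ≡⟨ sym (ℚₚ.*-assoc (x - 1ℚ) ((x - 1ℚ) ^ℚ k) (ev L x)) ⟩
    (x - 1ℚ) * ((x - 1ℚ) ^ℚ k) * ev L x             ∎
    where K = [X-1]^ k · L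

  [1-1]*≡0 : ∀ u v → (1ℚ - 1ℚ) * u * v ≡ 0ℚ
  [1-1]*≡0 u v = solve 2 (λ u v → (con 1ℚ :- con 1ℚ) :* u :* v := con 0ℚ) refl u v

  -- The coefficients of R are unknown, but division by the monic polynomial x - 1 preserves
  -- integrality, so the cofactor inherits it from f one linear factor at a time.
  integral-cofactor : ∀ k {f} R → Rep 𝒪 f → (∀ x → f x ≡ ((x - 1ℚ) ^ℚ k) * ev R x) → Rep 𝒪 (ev R)
  integral-cofactor zero R F h = Rep-resp (λ x → trans (h x) (ℚₚ.*-identityˡ (ev R x))) F
  integral-cofactor (suc k) {f} R (rep L c e) h = integral-cofactor k R (Rep-ev L′ (All-tail-quotient 𝒪-submodule 𝒪-1 L c))
    (λ x → trans (cancel-linear 1 L′ ([X-1]^ k · R) eq x) (ev-[X-1]^ k R x))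
    where
    L′ = tail-quotient 1ℚ L
    L1≡0 : ev L 1ℚ ≡ 0ℚ
    L1≡0 = trans (sym (e 1ℚ)) (trans (h 1ℚ) ([1-1]*≡0 ((1ℚ - 1ℚ) ^ℚ k) (ev R 1ℚ)))
    eq : ∀ x → (x - 1ℚ) * ev L′ x ≡ (x - 1ℚ) * ev ([X-1]^ k · R) x
    eq x = begin
      (x - 1ℚ) * ev L′ x                     ≡⟨ sym (ℚₚ.+-identityˡ ((x - 1ℚ) * ev L′ x)) ⟩
      0ℚ + (x - 1ℚ) * ev L′ x                ≡⟨ cong (_+ (x - 1ℚ) * ev L′ x) (sym L1≡0) ⟩
      ev L 1ℚ + (x - 1ℚ) * ev L′ x           ≡⟨ sym (ev-tail-quotient 1ℚ L x) ⟩
      ev L x                                 ≡⟨ trans (sym (e x)) (h x) ⟩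
      (x - 1ℚ) * ((x - 1ℚ) ^ℚ k) * ev R x    ≡⟨ ℚₚ.*-assoc (x - 1ℚ) ((x - 1ℚ) ^ℚ k) (ev R x) ⟩
      (x - 1ℚ) * (((x - 1ℚ) ^ℚ k) * ev R x)  ≡⟨ cong ((x - 1ℚ) *_) (sym (ev-[X-1]^ k R x)) ⟩
      (x - 1ℚ) * ev ([X-1]^ k · R) x         ∎

  length-tail-quotient : ∀ r L {k} → length L ≤ suc k → length (tail-quotient r L) ≤ k
  length-tail-quotient r [] h = z≤n
  length-tail-quotient r (a ∷ L) (s≤s h) = subst (_≤ _) (sym (length-quotient r L)) h

  -- Evaluating at 1 puts N(1) into 𝔪; subtract it, divide by x − 1 and lower k.
  vanishes-mod-𝔪 : ∀ k N {Z m} → length N ≤ k → All 𝒪 N → Rep 𝒪 Z → Rep 𝔪 m →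
    (∀ x → ev N x ≡ ((x - 1ℚ) ^ℚ k) * Z x + m x) → Rep 𝔪 (ev N)
  vanishes-mod-𝔪 zero [] len c RZ Rm h = Rep-const 𝔪-0
  vanishes-mod-𝔪 (suc k) N {Z} {m} len c RZ@(rep L _ eL) (rep M d eM) h =
    Rep-resp (λ x → sym (ev-tail-quotient 1ℚ N x))
      (Rep-+ 𝔪-submodule (Rep-const (subst 𝔪 (sym N1≡M1) (ev∈ 𝔪-submodule M d 𝒪-1)))
        (Rep-* 𝔪-submodule (Rep-- 𝒪-submodule Rep-X (Rep-const 𝒪-1))
          (vanishes-mod-𝔪 k N′ (length-tail-quotient 1ℚ N len) (All-tail-quotient 𝒪-submodule 𝒪-1 N c) RZ
            (Rep-ev M′ (All-tail-quotient 𝔪-submodule 𝒪-1 M d))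
            (λ x → trans (cancel-linear 1 N′ (([X-1]^ k · L) ⊕ M′) eq x) (evK x)))))
    where
    N′ = tail-quotient 1ℚ N
    M′ = tail-quotient 1ℚ M
    evK : ∀ x → ev (([X-1]^ k · L) ⊕ M′) x ≡ ((x - 1ℚ) ^ℚ k) * Z x + ev M′ x
    evK x = trans (ev-⊕ ([X-1]^ k · L) M′ x)
      (cong (_+ ev M′ x) (trans (ev-[X-1]^ k L x) (cong (((x - 1ℚ) ^ℚ k) *_) (sym (eL x)))))
    N1≡M1 : ev N 1ℚ ≡ ev M 1ℚ
    N1≡M1 = trans (h 1ℚ) (trans (cong₂ _+_ ([1-1]*≡0 ((1ℚ - 1ℚ) ^ℚ k) (Z 1ℚ)) (eM 1ℚ)) (ℚₚ.+-identityˡ (ev M 1ℚ)))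
    eq : ∀ x → (x - 1ℚ) * ev N′ x ≡ (x - 1ℚ) * ev (([X-1]^ k · L) ⊕ M′) x
    eq x = +-cancelˡ (ev M 1ℚ) ((x - 1ℚ) * ev N′ x) ((x - 1ℚ) * ev (([X-1]^ k · L) ⊕ M′) x) (begin
      ev M 1ℚ + (x - 1ℚ) * ev N′ x
        ≡⟨ cong (_+ (x - 1ℚ) * ev N′ x) (sym N1≡M1) ⟩
      ev N 1ℚ + (x - 1ℚ) * ev N′ x
        ≡⟨ sym (ev-tail-quotient 1ℚ N x) ⟩
      ev N x
        ≡⟨ trans (h x) (cong ((x - 1ℚ) * ((x - 1ℚ) ^ℚ k) * Z x +_) (trans (eM x) (ev-tail-quotient 1ℚ M x))) ⟩
      (x - 1ℚ) * ((x - 1ℚ) ^ℚ k) * Z x + (ev M 1ℚ + (x - 1ℚ) * ev M′ x)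
        ≡⟨ solve 5 (λ y g z u v → y :* g :* z :+ (u :+ y :* v) := u :+ y :* (g :* z :+ v)) refl (x - 1ℚ) ((x - 1ℚ) ^ℚ k) (Z x) (ev M 1ℚ) (ev M′ x) ⟩
      ev M 1ℚ + (x - 1ℚ) * (((x - 1ℚ) ^ℚ k) * Z x + ev M′ x)
        ≡⟨ cong (λ u → ev M 1ℚ + (x - 1ℚ) * u) (sym (evK x)) ⟩
      ev M 1ℚ + (x - 1ℚ) * ev (([X-1]^ k · L) ⊕ M′) x ∎)

  -- Modulo 𝔪 and (x − 1)^e₂ we have x^(e₁ + a) ≡ 1, so multiplying the relation by x^a turns it into
  -- P₁ ≡ x^a Q; both sides have degree < e₂, so they agree modulo 𝔪.
  padé : ∀ e₁ e₂ n ℓ low top q Q′ R → e₁ ℕ.+ length low ≡ n ℕ.* p ^ ℓ →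
    length low ℕ.+ suc (length Q′) ≤ e₂ → e₂ ≤ p ^ ℓ →
    All 𝒪 (low ++ top ∷ []) → All 𝒪 (q ∷ Q′) →
    (∀ x → (x ^ℚ e₁) * ev (low ++ top ∷ []) x - ev (q ∷ Q′) x ≡ ((x - 1ℚ) ^ℚ e₂) * ev R x) →
    All 𝔪 low × 𝔪 (top - q) × All 𝔪 Q′
  padé e₁ e₂ n ℓ low top q Q′ R hd hlen he₂ c₁ c₂ h =
    Allₚ.++⁻ˡ low All𝔪N , All.head 𝔪high ,
    All.map (λ {c} k → subst 𝔪 (solve 1 (λ c → :- (con (- 1ℚ) :* c) := c) refl c) (𝔪-neg k)) (Allₚ.map⁻ (All.tail 𝔪high))
    where
    a = length low
    P₁ = low ++ top ∷ []
    Q = q ∷ Q′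
    -- The coefficients of P₁ - x^a Q. As P₁ stops at x^a, the two polynomials overlap only there,
    -- so divisibility of this list by p controls the remaining coefficients of P₁ and of Q
    -- separately.
    N = low ++ (top - q) ∷ scale (- 1ℚ) Q′
    qℓ = p ^ ℓ
    r = qℓ ℕ.∸ e₂
    X-1 : Rep 𝒪 (λ x → x - 1ℚ)
    X-1 = Rep-- 𝒪-submodule Rep-X (Rep-const 𝒪-1)
    RP = Rep-ev P₁ c₁
    RR : Rep 𝒪 (ev R)
    RR = integral-cofactor e₂ R (Rep-- 𝒪-submodule (Rep-* 𝒪-submodule (Rep-^ e₁ Rep-X) RP) (Rep-ev Q c₂)) h
    Z₀ = proj₁ (X^[n*p^ℓ]-1 n ℓ)
    -- With d = e₁ + a, write P₁ - x^a Q = P₁ (1 - x^d) + x^a (x^e₁ P₁ - Q). Both summands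
    -- contribute a multiple of (x - 1)^e₂, collected in `Z`; the error in x^d - 1 ≡ (x - 1)^(p^ℓ)
    -- Z₀ goes into `m`.
    Z m : ℚ → ℚ
    Z x = (x ^ℚ a) * ev R x - ((x - 1ℚ) ^ℚ r) * Z₀ x * ev P₁ x
    m x = - 1ℚ * (ev P₁ x * ((x ^ℚ (n ℕ.* qℓ)) - 1ℚ - ((x - 1ℚ) ^ℚ qℓ) * Z₀ x))
    RZ : Rep 𝒪 Z
    RZ = Rep-- 𝒪-submodule (Rep-* 𝒪-submodule (Rep-^ a Rep-X) RR)
           (Rep-* 𝒪-submodule (Rep-* 𝒪-submodule (Rep-^ r X-1) (proj₁ (proj₂ (X^[n*p^ℓ]-1 n ℓ)))) RP)
    Rm : Rep 𝔪 m
    Rm = Rep-scale 𝔪-submodule (𝒪-neg 𝒪-1) (Rep-* 𝔪-submodule RP (proj₂ (proj₂ (X^[n*p^ℓ]-1 n ℓ))))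
    cN : All 𝒪 N
    cN = Allₚ.++⁺ (Allₚ.++⁻ˡ low c₁)
      (𝒪-+ (All.head (Allₚ.++⁻ʳ low c₁)) (𝒪-neg (All.head c₂)) ∷ All-scale 𝒪-submodule (𝒪-neg 𝒪-1) (All.tail c₂))
    power₁ : ∀ x → (x ^ℚ (n ℕ.* qℓ)) ≡ (x ^ℚ e₁) * (x ^ℚ a)
    power₁ x = trans (cong (x ^ℚ_) (sym hd)) (^-distribˡ-+ x e₁ a)
    power₂ : ∀ x → (x - 1ℚ) ^ℚ qℓ ≡ ((x - 1ℚ) ^ℚ e₂) * ((x - 1ℚ) ^ℚ r)
    power₂ x = trans (cong ((x - 1ℚ) ^ℚ_) (sym (ℕₚ.m+[n∸m]≡n he₂))) (^-distribˡ-+ (x - 1ℚ) e₂ r)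
    evN : ∀ x → ev N x ≡ ev P₁ x - (x ^ℚ a) * ev Q x
    evN x = begin
      ev N x
        ≡⟨ ev-++ low ((top - q) ∷ scale (- 1ℚ) Q′) x ⟩
      ev low x + (x ^ℚ a) * (top - q + x * ev (scale (- 1ℚ) Q′) x)
        ≡⟨ cong (λ u → ev low x + (x ^ℚ a) * (top - q + x * u)) (ev-scale (- 1ℚ) Q′ x) ⟩
      ev low x + (x ^ℚ a) * (top - q + x * (- 1ℚ * ev Q′ x))
        ≡⟨ solve 6 (λ l y t q x e → l :+ y :* (t :- q :+ x :* (con (- 1ℚ) :* e)) := (l :+ y :* (t :+ x :* con 0ℚ)) :- y :* (q :+ x :* e)) refl
             (ev low x) (x ^ℚ a) top q x (ev Q′ x) ⟩
      ev low x + (x ^ℚ a) * (top + x * 0ℚ) - (x ^ℚ a) * ev Q x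
        ≡⟨ cong (_- (x ^ℚ a) * ev Q x) (sym (ev-++ low (top ∷ []) x)) ⟩
      ev P₁ x - (x ^ℚ a) * ev Q x ∎
    eq : ∀ x → ev N x ≡ ((x - 1ℚ) ^ℚ e₂) * Z x + m x
    eq x = begin
      ev N x
        ≡⟨ evN x ⟩
      ev P₁ x - (x ^ℚ a) * ev Q x
        ≡⟨ solve 4 (λ P y Q w → P :- y :* Q := P :- w :* y :* P :+ y :* (w :* P :- Q)) refl (ev P₁ x) (x ^ℚ a) (ev Q x) (x ^ℚ e₁) ⟩
      ev P₁ x - (x ^ℚ e₁) * (x ^ℚ a) * ev P₁ x + (x ^ℚ a) * ((x ^ℚ e₁) * ev P₁ x - ev Q x)
        ≡⟨ cong (λ u → ev P₁ x - (x ^ℚ e₁) * (x ^ℚ a) * ev P₁ x + (x ^ℚ a) * u) (h x) ⟩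
      ev P₁ x - (x ^ℚ e₁) * (x ^ℚ a) * ev P₁ x + (x ^ℚ a) * (((x - 1ℚ) ^ℚ e₂) * ev R x)
        ≡⟨ solve 7 (λ P D y E R F z → P :- D :* P :+ y :* (E :* R) := E :* (y :* R :- F :* z :* P) :+ con (- 1ℚ) :* (P :* (D :- con 1ℚ :- E :* F :* z))) refl
             (ev P₁ x) ((x ^ℚ e₁) * (x ^ℚ a)) (x ^ℚ a) ((x - 1ℚ) ^ℚ e₂) (ev R x) ((x - 1ℚ) ^ℚ r) (Z₀ x) ⟩
      ((x - 1ℚ) ^ℚ e₂) * Z x + - 1ℚ * (ev P₁ x * ((x ^ℚ e₁) * (x ^ℚ a) - 1ℚ - ((x - 1ℚ) ^ℚ e₂) * ((x - 1ℚ) ^ℚ r) * Z₀ x))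
        ≡⟨ cong₂ (λ u v → ((x - 1ℚ) ^ℚ e₂) * Z x + - 1ℚ * (ev P₁ x * (u - 1ℚ - v * Z₀ x))) (sym (power₁ x)) (sym (power₂ x)) ⟩
      ((x - 1ℚ) ^ℚ e₂) * Z x + m x ∎
    lenN : length N ≤ e₂
    lenN = subst (_≤ e₂) (sym (trans (length-++ low) (cong (λ k → a ℕ.+ suc k) (length-map (- 1ℚ *_) Q′)))) hlen
    R𝔪N = vanishes-mod-𝔪 e₂ N lenN cN RZ Rm eq
    All𝔪N : All 𝔪 N
    All𝔪N = All-resp-ev 𝔪-0 N (coeffs R𝔪N) (f≡ev R𝔪N)
    𝔪high = Allₚ.++⁻ʳ low All𝔪N

  -- The factor is updated coefficient by coefficient: if sa is not integral, its reciprocal t lies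
  -- in 𝔪, and ts keeps the coefficients already treated integral while turning a into 1.
  primitive-scaling : ∀ L → All (_≡ 0ℚ) L ⊎ (∃[ s ] (All (λ a → 𝒪 (s * a)) L × Any (λ a → s * a ≡ 1ℚ) L))
  primitive-scaling [] = inj₁ []
  primitive-scaling (a ∷ L) = [ all-zero (a ≟ 0ℚ) , (λ (s , o , i) → inj₂ (scaled s o i (𝒪-or-inverse-𝔪 (s * a)))) ]′ (primitive-scaling L)
    where
    Goal = ∃[ s ] (All (λ b → 𝒪 (s * b)) (a ∷ L) × Any (λ b → s * b ≡ 1ℚ) (a ∷ L))
    all-zero : Dec (a ≡ 0ℚ) → All (_≡ 0ℚ) L → All (_≡ 0ℚ) (a ∷ L) ⊎ Goal
    all-zero (yes a≡0) zs = inj₁ (a≡0 ∷ zs)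
    all-zero (no a≢0) zs = inj₂ (t , subst 𝒪 (sym ta≡1) 𝒪-1 ∷ All.map (λ z → subst 𝒪 (sym (trans (cong (t *_) z) (ℚₚ.*-zeroʳ t))) 𝒪-0) zs , here ta≡1)
      where
      t = proj₁ (inv a a≢0)
      ta≡1 = trans (ℚₚ.*-comm t a) (proj₂ (inv a a≢0))
    scaled : ∀ s → All (λ b → 𝒪 (s * b)) L → Any (λ b → s * b ≡ 1ℚ) L → 𝒪 (s * a) ⊎ (∃[ t ] (𝔪 t × s * a * t ≡ 1ℚ)) → Goal
    scaled s o i (inj₁ k) = s , k ∷ o , there i
    scaled s o i (inj₂ (t , 𝔪t , e)) = t * s , subst 𝒪 (sym tsa≡1) 𝒪-1 ∷ All.map (λ {b} k → subst 𝒪 (sym (ℚₚ.*-assoc t s b)) (𝒪-* (𝔪⇒𝒪 𝔪t) k)) o , here tsa≡1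
      where tsa≡1 = trans (solve 3 (λ t s a → t :* s :* a := s :* a :* t) refl t s a) e

  -- Reduction of a Belyi map modulo p

  unsnoc : ∀ n (L : Poly) → length L ≡ suc n → Σ Poly λ low → Σ ℚ λ top → L ≡ low ++ top ∷ [] × length low ≡ n
  unsnoc zero    (a ∷ [])    e = [] , a , refl , refl
  unsnoc (suc n) (a ∷ b ∷ L) e =
    let low , top , eq , len = unsnoc n (b ∷ L) (ℕₚ.suc-injective e)
    in  a ∷ low , top , cong (a ∷_) eq , cong suc len

  uncons : ∀ n (L : Poly) → length L ≡ suc n → Σ ℚ λ q → Σ Poly λ Q′ → L ≡ q ∷ Q′ × length Q′ ≡ n
  uncons n (q ∷ Q′) e = q , Q′ , refl , ℕₚ.suc-injective e

  ev-zeros : ∀ L → All (_≡ 0ℚ) L → ∀ x → ev L x ≡ 0ℚ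
  ev-zeros [] [] x = refl
  ev-zeros (a ∷ L) (z ∷ zs) x = trans (cong₂ (λ u v → u + x * v) z (ev-zeros L zs x)) (trans (ℚₚ.+-identityˡ (x * 0ℚ)) (ℚₚ.*-zeroʳ x))

  -- Numerator and denominator share one scaling factor, as only their ratio matters. The length
  -- bounds mean deg m₁ ≤ d and deg m₂ ≤ d - 2, the latter from e₃ ≥ 2; they control the map near ∞.
  record MonomialReduction (d : ℕ) (P Q : Poly) : Set where
    field
      s              : ℚ
      m₁ m₂          : Poly
      𝔪m₁            : All 𝔪 m₁
      𝔪m₂            : All 𝔪 m₂
      length-m₁      : length m₁ ≤ suc d
      length-m₂      : length m₂ ≤ d ℕ.∸ 1
      numerator≡     : ∀ x → s * ev P x ≡ (x ^ℚ d) + ev m₁ x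
      denominator≡   : ∀ x → s * ev Q x ≡ 1ℚ + ev m₂ x

  module _ {d e₁ e₂ e₃ P Q} (belyi : IsNormalizedBelyi d e₁ e₂ e₃ P Q)
           (n ℓ : ℕ) (d≡ : d ≡ n ℕ.* p ^ ℓ) (e₂≤ : e₂ ≤ p ^ ℓ) where
    open IsNormalizedBelyi belyi

    private
      a = d ℕ.∸ e₁
      b = d ℕ.∸ e₃
      P₁ = drop e₁ P

      e₁+a≡d : e₁ ℕ.+ a ≡ d
      e₁+a≡d = ℕₚ.m+[n∸m]≡n e₁≤d

      -- The relation e₁ + e₂ + e₃ = 2d + 1 is Riemann-Hurwitz in genus 0; it gives P₁ - x^a Q
      -- exactly e₂ coefficients, few enough for a factor (x - 1)^e₂ modulo p to force them all to
      -- vanish.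
      a+b+1≡e₂ : a ℕ.+ suc b ≡ e₂
      a+b+1≡e₂ = ℕₚ.+-cancelˡ-≡ (e₁ ℕ.+ e₃) (a ℕ.+ suc b) e₂ (begin
        e₁ ℕ.+ e₃ ℕ.+ (a ℕ.+ suc b)
          ≡⟨ ℕS.solve 4 (λ e₁ e₃ a b → e₁ ℕS.:+ e₃ ℕS.:+ (a ℕS.:+ (ℕS.con 1 ℕS.:+ b)) ℕS.:= (e₁ ℕS.:+ a) ℕS.:+ (e₃ ℕS.:+ b) ℕS.:+ ℕS.con 1) refl e₁ e₃ a b ⟩
        (e₁ ℕ.+ a) ℕ.+ (e₃ ℕ.+ b) ℕ.+ 1
          ≡⟨ cong₂ (λ u v → u ℕ.+ v ℕ.+ 1) e₁+a≡d (trans (ℕₚ.m+[n∸m]≡n e₃≤d) (sym (ℕₚ.+-identityʳ d))) ⟩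
        2 ℕ.* d ℕ.+ 1
          ≡⟨ sym sum-e ⟩
        e₁ ℕ.+ e₂ ℕ.+ e₃
          ≡⟨ ℕS.solve 3 (λ e₁ e₂ e₃ → e₁ ℕS.:+ e₂ ℕS.:+ e₃ ℕS.:= e₁ ℕS.:+ e₃ ℕS.:+ e₂) refl e₁ e₂ e₃ ⟩
        e₁ ℕ.+ e₃ ℕ.+ e₂ ∎)

      length-P₁ : length P₁ ≡ suc a
      length-P₁ = trans (length-drop e₁ P) (trans (cong (ℕ._∸ e₁) (proj₁ degP)) (ℕₚ.+-∸-assoc 1 e₁≤d))

      P≡ : ∀ x → ev P x ≡ (x ^ℚ e₁) * ev P₁ x
      P≡ = ev-drop e₁ P (proj₁ ram0) (proj₁ (proj₂ ram0))

      ¬all-zero : ¬ All (_≡ 0ℚ) (P₁ ++ Q)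
      ¬all-zero zs = ℚₚ.1≢0 (begin
        1ℚ                                            ≡⟨ sym (proj₂ (proj₂ coprime) 0ℚ) ⟩
        ev A 0ℚ * ev P 0ℚ + ev B 0ℚ * ev Q 0ℚ         ≡⟨ cong₂ (λ u v → ev A 0ℚ * u + ev B 0ℚ * v) (trans (P≡ 0ℚ) (cong ((0ℚ ^ℚ e₁) *_) (ev-zeros P₁ (Allₚ.++⁻ˡ P₁ zs) 0ℚ))) (ev-zeros Q (Allₚ.++⁻ʳ P₁ zs) 0ℚ) ⟩
        ev A 0ℚ * ((0ℚ ^ℚ e₁) * 0ℚ) + ev B 0ℚ * 0ℚ    ≡⟨ solve 3 (λ u v w → u :* (v :* con 0ℚ) :+ w :* con 0ℚ := con 0ℚ) refl (ev A 0ℚ) (0ℚ ^ℚ e₁) (ev B 0ℚ) ⟩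
        0ℚ ∎)
        where
        A = proj₁ coprime
        B = proj₁ (proj₂ coprime)

      module _ (s : ℚ) (low : Poly) (top q : ℚ) (Q′ : Poly)
               (sP₁≡ : scale s P₁ ≡ low ++ top ∷ []) (sQ≡ : scale s Q ≡ q ∷ Q′)
               (len-low : length low ≡ a) (len-Q′ : length Q′ ≡ b)
               (c₁ : All 𝒪 (low ++ top ∷ [])) (c₂ : All 𝒪 (q ∷ Q′))
               (some-1 : Any (_≡ 1ℚ) ((low ++ top ∷ []) ++ q ∷ Q′)) where

        evP₁ : ∀ x → s * ev P₁ x ≡ ev (low ++ top ∷ []) x
        evP₁ x = trans (sym (ev-scale s P₁ x)) (cong (λ L → ev L x) sP₁≡)

        evQ : ∀ x → s * ev Q x ≡ ev (q ∷ Q′) x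
        evQ x = trans (sym (ev-scale s Q x)) (cong (λ L → ev L x) sQ≡)

        R = proj₁ ram1

        difference : ∀ x → (x ^ℚ e₁) * ev (low ++ top ∷ []) x - ev (q ∷ Q′) x ≡ ((x - 1ℚ) ^ℚ e₂) * ev (scale s R) x
        difference x = begin
          (x ^ℚ e₁) * ev (low ++ top ∷ []) x - ev (q ∷ Q′) x  ≡⟨ cong₂ (λ u v → (x ^ℚ e₁) * u - v) (sym (evP₁ x)) (sym (evQ x)) ⟩
          (x ^ℚ e₁) * (s * ev P₁ x) - s * ev Q x              ≡⟨ solve 4 (λ y s P Q → y :* (s :* P) :- s :* Q := s :* (y :* P :- Q)) refl (x ^ℚ e₁) s (ev P₁ x) (ev Q x) ⟩
          s * ((x ^ℚ e₁) * ev P₁ x - ev Q x)                  ≡⟨ cong (λ u → s * (u - ev Q x)) (sym (P≡ x)) ⟩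
          s * (ev P x - ev Q x)                               ≡⟨ cong (s *_) (proj₁ (proj₂ ram1) x) ⟩
          s * (((x - 1ℚ) ^ℚ e₂) * ev R x)                     ≡⟨ solve 3 (λ s y r → s :* (y :* r) := y :* (s :* r)) refl s ((x - 1ℚ) ^ℚ e₂) (ev R x) ⟩
          ((x - 1ℚ) ^ℚ e₂) * (s * ev R x)                     ≡⟨ cong (((x - 1ℚ) ^ℚ e₂) *_) (sym (ev-scale s R x)) ⟩
          ((x - 1ℚ) ^ℚ e₂) * ev (scale s R) x                 ∎

        congruences = padé e₁ e₂ n ℓ low top q Q′ (scale s R)
          (trans (cong (e₁ ℕ.+_) len-low) (trans e₁+a≡d d≡))
          (ℕₚ.≤-reflexive (trans (cong₂ (λ u v → u ℕ.+ suc v) len-low len-Q′) a+b+1≡e₂))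
          e₂≤ c₁ c₂ difference
        𝔪low = proj₁ congruences
        𝔪top-q = proj₁ (proj₂ congruences)
        𝔪Q′ = proj₂ (proj₂ congruences)

        -- The congruences leave q as the only residue, shared by `top`; the coefficient equal to 1
        -- prevents it from being zero.
        ¬𝔪q : ¬ 𝔪 q
        ¬𝔪q 𝔪q = ¬𝔪-1 (let 𝔪a , a≡1 = All.lookupAny all-𝔪 some-1 in subst 𝔪 a≡1 𝔪a)
          where
          all-𝔪 : All 𝔪 ((low ++ top ∷ []) ++ q ∷ Q′)
          all-𝔪 = Allₚ.++⁺ (Allₚ.++⁺ 𝔪low (subst 𝔪 (solve 2 (λ t q → t :- q :+ q := t) refl top q) (𝔪-+ 𝔪top-q 𝔪q) ∷ [])) (𝔪q ∷ 𝔪Q′)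

        normalise : Unit q → MonomialReduction d P Q
        normalise (unit u 𝒪u qu≡1) = record
          { s            = u * s
          ; m₁           = X^ e₁ · m
          ; m₂           = 0ℚ ∷ scale u Q′
          ; 𝔪m₁          = All-X^ e₁ (All-scale 𝔪-submodule 𝒪u (Allₚ.++⁺ 𝔪low (𝔪top-q ∷ [])))
          ; 𝔪m₂          = 𝔪-0 ∷ All-scale 𝔪-submodule 𝒪u 𝔪Q′
          ; length-m₁    = ℕₚ.≤-reflexive length-m₁
          ; length-m₂    = subst (_≤ d ℕ.∸ 1) (cong suc (sym (trans (length-map (u *_) Q′) len-Q′)))
                             (ℕₚ.∸-monoʳ-< 2≤e₃ e₃≤d)
          ; numerator≡   = numerator
          ; denominator≡ = denominator
          }
          where
          m = scale u (low ++ (top - q) ∷ [])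
          All-X^ : ∀ e {L} → All 𝔪 L → All 𝔪 (X^ e · L)
          All-X^ zero c = c
          All-X^ (suc e) c = 𝔪-0 ∷ All-X^ e c
          length-m₁ : length (X^ e₁ · m) ≡ suc d
          length-m₁ = trans (length-X^ e₁ m) (trans (cong (e₁ ℕ.+_) (trans (length-map (u *_) (low ++ (top - q) ∷ [])) (trans (length-++ low) (trans (ℕₚ.+-comm (length low) 1) (cong suc len-low)))))
                        (trans (ℕₚ.+-suc e₁ a) (cong suc e₁+a≡d)))
          numerator : ∀ x → u * s * ev P x ≡ (x ^ℚ d) + ev (X^ e₁ · m) x
          numerator x = begin
            u * s * ev P x
              ≡⟨ cong (u * s *_) (P≡ x) ⟩
            u * s * ((x ^ℚ e₁) * ev P₁ x)
              ≡⟨ solve 4 (λ u s y P → u :* s :* (y :* P) := y :* (u :* (s :* P))) refl u s (x ^ℚ e₁) (ev P₁ x) ⟩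
            (x ^ℚ e₁) * (u * (s * ev P₁ x))
              ≡⟨ cong (λ v → (x ^ℚ e₁) * (u * v)) (trans (evP₁ x) (ev-++ low (top ∷ []) x)) ⟩
            (x ^ℚ e₁) * (u * (ev low x + (x ^ℚ length low) * (top + x * 0ℚ)))
              ≡⟨ solve 7 (λ y u l z t x q → y :* (u :* (l :+ z :* (t :+ x :* con 0ℚ))) := y :* z :* (q :* u) :+ y :* (u :* (l :+ z :* (t :- q :+ x :* con 0ℚ)))) refl
                   (x ^ℚ e₁) u (ev low x) (x ^ℚ length low) top x q ⟩
            (x ^ℚ e₁) * (x ^ℚ length low) * (q * u) + (x ^ℚ e₁) * (u * (ev low x + (x ^ℚ length low) * (top - q + x * 0ℚ)))
              ≡⟨ cong₂ (λ v w → v + (x ^ℚ e₁) * w)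
                   (trans (cong ((x ^ℚ e₁) * (x ^ℚ length low) *_) qu≡1) (trans (ℚₚ.*-identityʳ ((x ^ℚ e₁) * (x ^ℚ length low)))
                     (trans (sym (^-distribˡ-+ x e₁ (length low))) (cong (x ^ℚ_) (trans (cong (e₁ ℕ.+_) len-low) e₁+a≡d)))))
                   (sym (trans (ev-scale u (low ++ (top - q) ∷ []) x) (cong (u *_) (ev-++ low ((top - q) ∷ []) x)))) ⟩
            (x ^ℚ d) + (x ^ℚ e₁) * ev m x
              ≡⟨ cong ((x ^ℚ d) +_) (sym (ev-X^ e₁ m x)) ⟩
            (x ^ℚ d) + ev (X^ e₁ · m) x ∎
          denominator : ∀ x → u * s * ev Q x ≡ 1ℚ + ev (0ℚ ∷ scale u Q′) x
          denominator x = begin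
            u * s * ev Q x                    ≡⟨ ℚₚ.*-assoc u s (ev Q x) ⟩
            u * (s * ev Q x)                  ≡⟨ cong (u *_) (evQ x) ⟩
            u * (q + x * ev Q′ x)             ≡⟨ solve 4 (λ u q x e → u :* (q :+ x :* e) := q :* u :+ (con 0ℚ :+ x :* (u :* e))) refl u q x (ev Q′ x) ⟩
            q * u + (0ℚ + x * (u * ev Q′ x))  ≡⟨ cong₂ (λ v w → v + (0ℚ + x * w)) qu≡1 (sym (ev-scale u Q′ x)) ⟩
            1ℚ + ev (0ℚ ∷ scale u Q′) x       ∎

        reduction-scaled : MonomialReduction d P Q
        reduction-scaled = [ ⊥-elim ∘ ¬𝔪q , normalise ]′ (𝔪-or-unit (All.head c₂))

      split : ∃[ s ] (All (λ c → 𝒪 (s * c)) (P₁ ++ Q) × Any (λ c → s * c ≡ 1ℚ) (P₁ ++ Q)) → MonomialReduction d P Q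
      split (s , integral , some-1) =
        let low , top , sP₁≡ , len-low = unsnoc a (scale s P₁) (trans (length-map (s *_) P₁) length-P₁)
            q , Q′ , sQ≡ , len-Q′ = uncons b (scale s Q) (trans (length-map (s *_) Q) (proj₁ degQ))
        in reduction-scaled s low top q Q′ sP₁≡ sQ≡ len-low len-Q′
             (subst (All 𝒪) sP₁≡ (Allₚ.map⁺ (Allₚ.++⁻ˡ P₁ integral)))
             (subst (All 𝒪) sQ≡ (Allₚ.map⁺ (Allₚ.++⁻ʳ P₁ integral)))
             (subst (Any (_≡ 1ℚ)) (trans (map-++ (s *_) P₁ Q) (cong₂ _++_ sP₁≡ sQ≡)) (Anyₚ.map⁺ some-1))

    monomialReduction : MonomialReduction d P Q
    monomialReduction = [ ⊥-elim ∘ ¬all-zero , split ]′ (primitive-scaling (P₁ ++ Q))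

  -- The residue map x ↦ x^d

  ℕ→ℚ-suc : ∀ n → ℕ→ℚ (suc n) ≡ 1ℚ + ℕ→ℚ n
  ℕ→ℚ-suc = ℕ→ℚ-+ 1

  -- By `freshman`, the residue of y^p - y is unchanged when y is replaced by y + 1, so its
  -- vanishing spreads from 0 to all integers, upwards and downwards.
  fermat-difference : ∀ {y} → 𝒪 y → 𝔪 (((1ℚ + y) ^ℚ p) - (1ℚ + y) - ((y ^ℚ p) - y))
  fermat-difference {y} h = subst 𝔪 (solve 3 (λ a b y → a :- (con 1ℚ :+ b) := a :- (con 1ℚ :+ y) :- (b :- y)) refl ((1ℚ + y) ^ℚ p) (y ^ℚ p) y)
    (Rep-value 𝔪-submodule freshman h)

  fermat-suc : ∀ {y} → 𝒪 y → 𝔪 ((y ^ℚ p) - y) → 𝔪 (((1ℚ + y) ^ℚ p) - (1ℚ + y))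
  fermat-suc {y} h k = subst 𝔪 (solve 2 (λ a b → a :- b :+ b := a) refl (((1ℚ + y) ^ℚ p) - (1ℚ + y)) ((y ^ℚ p) - y)) (𝔪-+ (fermat-difference h) k)

  fermat-pred : ∀ {y} → 𝒪 y → 𝔪 (((1ℚ + y) ^ℚ p) - (1ℚ + y)) → 𝔪 ((y ^ℚ p) - y)
  fermat-pred {y} h k = subst 𝔪 (solve 2 (λ a b → a :- (a :- b) := b) refl (((1ℚ + y) ^ℚ p) - (1ℚ + y)) ((y ^ℚ p) - y)) (𝔪-- k (fermat-difference h))

  fermat-ι : ∀ n → 𝔪 ((ι n ^ℚ p) - ι n)
  fermat-ι (ℤ.+ zero) = go p (prime⇒nonZero pp)
    where
    go : ∀ k → ℕ.NonZero k → 𝔪 ((0ℚ ^ℚ k) - 0ℚ)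
    go (suc k) _ = subst 𝔪 (solve 1 (λ y → con 0ℚ := con 0ℚ :* y :- con 0ℚ) refl (0ℚ ^ℚ k)) 𝔪-0
  fermat-ι (ℤ.+ suc n) = subst (λ z → 𝔪 ((z ^ℚ p) - z)) (sym (ℕ→ℚ-suc n)) (fermat-suc (𝒪-ι (ℤ.+ n)) (fermat-ι (ℤ.+ n)))
  fermat-ι ℤ.-[1+ zero ] = fermat-pred (𝒪-ι ℤ.-[1+ 0 ]) (fermat-ι (ℤ.+ 0))
  fermat-ι ℤ.-[1+ suc n ] = fermat-pred (𝒪-ι ℤ.-[1+ suc n ])
    (subst (λ z → 𝔪 ((z ^ℚ p) - z)) (ι-+ (ℤ.+ 1) ℤ.-[1+ suc n ]) (fermat-ι ℤ.-[1+ n ]))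

  -- For y = a/b, the number b (y^p - y) equals (a^p - a) - y^p (b^p - b), which is in 𝔪 by the case
  -- of integers; and p ∤ b.
  fermat : ∀ {y} → 𝒪 y → 𝔪 ((y ^ℚ p) - y)
  fermat {y} h@(frac b a p∤b e) = [ (λ k → ⊥-elim (p∤b (𝔪⇒∣ b k))) , id ]′
    (𝔪-prime ((y ^ℚ p) - y) (𝒪-ι b) (subst 𝔪 eq
      (𝔪-- (fermat-ι a) (𝔪-*ˡ (𝒪-^ p h) (fermat-ι b)))))
    where
    eq : (ι a ^ℚ p) - ι a - (y ^ℚ p) * ((ι b ^ℚ p) - ι b) ≡ ι b * ((y ^ℚ p) - y)
    eq = begin
      (ι a ^ℚ p) - ι a - (y ^ℚ p) * ((ι b ^ℚ p) - ι b)
        ≡⟨ cong (λ u → (u ^ℚ p) - u - (y ^ℚ p) * ((ι b ^ℚ p) - ι b)) (sym e) ⟩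
      ((y * ι b) ^ℚ p) - y * ι b - (y ^ℚ p) * ((ι b ^ℚ p) - ι b)
        ≡⟨ cong (λ u → u - y * ι b - (y ^ℚ p) * ((ι b ^ℚ p) - ι b)) (*-^ y (ι b) p) ⟩
      (y ^ℚ p) * (ι b ^ℚ p) - y * ι b - (y ^ℚ p) * ((ι b ^ℚ p) - ι b)
        ≡⟨ solve 4 (λ Y B y b → Y :* B :- y :* b :- Y :* (B :- b) := b :* (Y :- y)) refl (y ^ℚ p) (ι b ^ℚ p) y (ι b) ⟩
      ι b * ((y ^ℚ p) - y) ∎

  𝔪-^-cong : ∀ {x y} n → 𝒪 x → 𝒪 y → 𝔪 (x - y) → 𝔪 ((x ^ℚ n) - (y ^ℚ n))
  𝔪-^-cong zero hx hy h = subst 𝔪 (sym (ℚₚ.+-inverseʳ 1ℚ)) 𝔪-0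
  𝔪-^-cong {x} {y} (suc n) hx hy h = subst 𝔪
    (solve 4 (λ x y u v → x :* (u :- v) :+ (x :- y) :* v := x :* u :- y :* v) refl x y (x ^ℚ n) (y ^ℚ n))
    (𝔪-+ (𝔪-*ˡ hx (𝔪-^-cong n hx hy h)) (𝔪-*ʳ h (𝒪-^ n hy)))

  fermat-iterate : ∀ ℓ {y} → 𝒪 y → 𝔪 ((y ^ℚ (p ^ ℓ)) - y)
  fermat-iterate zero {y} h = subst 𝔪 (solve 1 (λ y → con 0ℚ := y :* con 1ℚ :- y) refl y) 𝔪-0
  fermat-iterate (suc ℓ) {y} h = subst (λ z → 𝔪 (z - y)) (sym (trans (cong (y ^ℚ_) (ℕₚ.*-comm p (p ^ ℓ))) (^-* y (p ^ ℓ) p)))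
    (𝔪-trans ((y ^ℚ (p ^ ℓ)) ^ℚ p) (y ^ℚ (p ^ ℓ)) y (fermat (𝒪-^ (p ^ ℓ) h)) (fermat-iterate ℓ h))

  ^-fixes-0-1 : ∀ {y} n → 𝒪 y → 𝔪 y ⊎ 𝔪 (y - 1ℚ) → 𝔪 ((y ^ℚ suc n) - y)
  ^-fixes-0-1 {y} n hy (inj₁ k) = 𝔪-- (𝔪-*ʳ k (𝒪-^ n hy)) k
  ^-fixes-0-1 {y} n hy (inj₂ k) = 𝔪-trans (y ^ℚ suc n) 1ℚ y
    (subst (λ z → 𝔪 ((y ^ℚ suc n) - z)) (1^ (suc n)) (𝔪-^-cong (suc n) hy 𝒪-1 k))
    (𝔪-swap y 1ℚ k)

  Idempotent : ℕ → Set
  Idempotent d = ∀ {y} → 𝒪 y → 𝔪 (((y ^ℚ d) ^ℚ d) - (y ^ℚ d))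

  -- By Fermat, z = y^d satisfies z (z - 1) ≡ 0, and the residues 0 and 1 are fixed by all positive
  -- powers.
  idempotent-2 : p ≡ 2 → ∀ n → Idempotent (suc n)
  idempotent-2 p≡2 n {y} hy = ^-fixes-0-1 n hz (𝔪-prime (z - 1ℚ) hz
    (subst 𝔪 (solve 1 (λ z → z :* (z :* con 1ℚ) :- z := z :* (z :- con 1ℚ)) refl z) (subst (λ k → 𝔪 ((z ^ℚ k) - z)) p≡2 (fermat hz))))
    where
    z = y ^ℚ suc n
    hz = 𝒪-^ (suc n) hy

  residue-3 : p ≡ 3 → ∀ {z} → 𝒪 z → (𝔪 z ⊎ 𝔪 (z - 1ℚ)) ⊎ 𝔪 (z + 1ℚ)
  residue-3 p≡3 {z} hz = [ (λ k → inj₁ (inj₁ k)) , (λ k → Sum.map₁ inj₂ (𝔪-prime (z + 1ℚ) (𝒪-+ hz (𝒪-neg 𝒪-1)) k)) ]′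
    (𝔪-prime ((z - 1ℚ) * (z + 1ℚ)) hz (subst 𝔪 (solve 1 (λ z → z :* (z :* (z :* con 1ℚ)) :- z := z :* ((z :- con 1ℚ) :* (z :+ con 1ℚ))) refl z)
      (subst (λ k → 𝔪 ((z ^ℚ k) - z)) p≡3 (fermat hz))))

  -- The residues 0 and 1 of z = y^d are fixed by every positive power. If z ≡ -1, then z ≡ y
  -- whatever the residue of y: either y is 0 or 1 and so agrees with its power, or y ≡ -1 too.
  -- Hence z^d ≡ y^d = z.
  idempotent-3 : p ≡ 3 → ∀ n → Idempotent (suc n)
  idempotent-3 p≡3 n {y} hy = [ ^-fixes-0-1 n hz , (λ z≡-1 → [ fixed , (λ y≡-1 → 𝔪-^-cong (suc n) hz hy (subst 𝔪 (solve 2 (λ z y → z :+ con 1ℚ :- (y :+ con 1ℚ) := z :- y) refl z y) (𝔪-- z≡-1 y≡-1))) ]′ (residue-3 p≡3 hy)) ]′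
    (residue-3 p≡3 hz)
    where
    z = y ^ℚ suc n
    hz = 𝒪-^ (suc n) hy
    fixed : 𝔪 y ⊎ 𝔪 (y - 1ℚ) → 𝔪 ((z ^ℚ suc n) - z)
    fixed h = 𝔪-^-cong (suc n) hz hy (^-fixes-0-1 n hy h)

  idempotent-p^ : ∀ ℓ → Idempotent (p ^ ℓ)
  idempotent-p^ ℓ hy = fermat-iterate ℓ (𝒪-^ (p ^ ℓ) hy)

  -- Difference quotients of powers, and polynomials near ∞

  powerQuotient : ℚ → ℚ → ℕ → ℚ
  powerQuotient x y zero    = 0ℚ
  powerQuotient x y (suc n) = (x ^ℚ n) + y * powerQuotient x y n

  -- `powerQuotient x y n` is the sum of x^i y^j over i + j = n - 1.
  ^-difference : ∀ x y n → (x ^ℚ n) - (y ^ℚ n) ≡ (x - y) * powerQuotient x y n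
  ^-difference x y zero = trans (ℚₚ.+-inverseʳ 1ℚ) (sym (ℚₚ.*-zeroʳ (x - y)))
  ^-difference x y (suc n) = begin
    x * (x ^ℚ n) - y * (y ^ℚ n)
      ≡⟨ solve 4 (λ x y u v → x :* u :- y :* v := (x :- y) :* u :+ y :* (u :- v)) refl x y (x ^ℚ n) (y ^ℚ n) ⟩
    (x - y) * (x ^ℚ n) + y * ((x ^ℚ n) - (y ^ℚ n))
      ≡⟨ cong (λ w → (x - y) * (x ^ℚ n) + y * w) (^-difference x y n) ⟩
    (x - y) * (x ^ℚ n) + y * ((x - y) * powerQuotient x y n)
      ≡⟨ solve 4 (λ d u y s → d :* u :+ y :* (d :* s) := d :* (u :+ y :* s)) refl (x - y) (x ^ℚ n) y (powerQuotient x y n) ⟩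
    (x - y) * ((x ^ℚ n) + y * powerQuotient x y n) ∎

  -- For x ≡ y each of the n summands is congruent to y^(n-1); the factor y avoids the exponent n -
  -- 1.
  y*powerQuotient : ∀ {x y} n → 𝒪 x → 𝒪 y → 𝔪 (x - y) → 𝔪 (y * powerQuotient x y n - ℕ→ℚ n * (y ^ℚ n))
  y*powerQuotient {x} {y} zero hx hy h = subst 𝔪 (solve 1 (λ y → con 0ℚ := y :* con 0ℚ :- con 0ℚ :* con 1ℚ) refl y) 𝔪-0
  y*powerQuotient {x} {y} (suc n) hx hy h = subst 𝔪 eq
    (𝔪-*ˡ hy (𝔪-+ (𝔪-^-cong n hx hy h) (y*powerQuotient n hx hy h)))
    where
    S = powerQuotient x y n
    eq : y * ((x ^ℚ n) - (y ^ℚ n) + (y * S - ℕ→ℚ n * (y ^ℚ n))) ≡ y * ((x ^ℚ n) + y * S) - ℕ→ℚ (suc n) * (y * (y ^ℚ n))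
    eq = trans (solve 5 (λ y u v s k → y :* (u :- v :+ (y :* s :- k :* v)) := y :* (u :+ y :* s) :- (con 1ℚ :+ k) :* (y :* v)) refl y (x ^ℚ n) (y ^ℚ n) S (ℕ→ℚ n))
      (cong (λ k → y * ((x ^ℚ n) + y * S) - k * (y * (y ^ℚ n))) (sym (ℕ→ℚ-suc n)))

  -- Modulo 𝔪 the difference quotient is the derivative (n + 1) y^n, which p ∣ n + 1 annihilates.
  -- This is the source of the contraction.
  𝔪-powerQuotient : ∀ {x y} n → p ∣ suc n → 𝒪 x → 𝒪 y → 𝔪 (x - y) → 𝔪 (powerQuotient x y (suc n))
  𝔪-powerQuotient {x} {y} n p∣ hx hy h = subst 𝔪 eq
    (𝔪-+ (𝔪-+ (𝔪-^-cong n hx hy h) (y*powerQuotient n hx hy h)) (𝔪-*ʳ (∣⇒𝔪 (ℤ.+ suc n) p∣) (𝒪-^ n hy)))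
    where
    S = powerQuotient x y n
    eq : (x ^ℚ n) - (y ^ℚ n) + (y * S - ℕ→ℚ n * (y ^ℚ n)) + ℕ→ℚ (suc n) * (y ^ℚ n) ≡ (x ^ℚ n) + y * S
    eq = trans (cong (λ k → (x ^ℚ n) - (y ^ℚ n) + (y * S - ℕ→ℚ n * (y ^ℚ n)) + k * (y ^ℚ n)) (ℕ→ℚ-suc n))
      (solve 4 (λ u v ys k → u :- v :+ (ys :- k :* v) :+ (con 1ℚ :+ k) :* v := u :+ ys) refl (x ^ℚ n) (y ^ℚ n) (y * S) (ℕ→ℚ n))

  -- With t = 1/x, the number t^n L(x) is the value at t of the reversed polynomial, which has the
  -- same coefficients and an integral argument.
  reverse-value : ∀ {𝒞 x t} → Submodule 𝒞 → 𝒪 t → x * t ≡ 1ℚ → ∀ n L → length L ≤ suc n → All 𝒞 L → 𝒞 ((t ^ℚ n) * ev L x)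
  reverse-value {𝒞} {x} {t} S ht xt≡1 n [] len [] = subst 𝒞 (sym (ℚₚ.*-zeroʳ (t ^ℚ n))) (0∈ S)
  reverse-value {𝒞} {x} {t} S ht xt≡1 zero (c ∷ []) len (k ∷ []) =
    subst 𝒞 (solve 2 (λ c x → c := con 1ℚ :* (c :+ x :* con 0ℚ)) refl c x) k
  reverse-value S ht xt≡1 zero (c ∷ c′ ∷ L) (s≤s ()) cs
  reverse-value {𝒞} {x} {t} S ht xt≡1 (suc n) (c ∷ L) (s≤s len) (k ∷ ks) =
    subst 𝒞 eq (+∈ S (∙∈ S (𝒪-^ (suc n) ht) k) (reverse-value S ht xt≡1 n L len ks))
    where
    eq : t * (t ^ℚ n) * c + (t ^ℚ n) * ev L x ≡ t * (t ^ℚ n) * (c + x * ev L x)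
    eq = begin
      t * (t ^ℚ n) * c + (t ^ℚ n) * ev L x
        ≡⟨ cong (λ u → t * (t ^ℚ n) * c + u) (sym (trans (cong (_* ((t ^ℚ n) * ev L x)) xt≡1) (ℚₚ.*-identityˡ ((t ^ℚ n) * ev L x)))) ⟩
      t * (t ^ℚ n) * c + x * t * ((t ^ℚ n) * ev L x)
        ≡⟨ solve 5 (λ t w c x e → t :* w :* c :+ x :* t :* (w :* e) := t :* w :* (c :+ x :* e)) refl t (t ^ℚ n) c x (ev L x) ⟩
      t * (t ^ℚ n) * (c + x * ev L x) ∎

  -- Periodic orbits

  record Step (P Q : Poly) (x x′ : ℚ) : Set where
    constructor step
    field
      x′*Q≡P : x′ * ev Q x ≡ ev P x

  module _ {k : ℕ} {P Q : Poly} (reduction : MonomialReduction (suc (suc k)) P Q)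
           (p∣d : p ∣ suc (suc k)) (idempotent : Idempotent (suc (suc k))) where
    open MonomialReduction reduction

    private
      d = suc (suc k)

      step-reduced : ∀ {x x′} → Step P Q x x′ → x′ * (1ℚ + ev m₂ x) ≡ (x ^ℚ d) + ev m₁ x
      step-reduced {x} {x′} (step st) = begin
        x′ * (1ℚ + ev m₂ x)  ≡⟨ cong (x′ *_) (sym (denominator≡ x)) ⟩
        x′ * (s * ev Q x)    ≡⟨ solve 3 (λ x s q → x :* (s :* q) := s :* (x :* q)) refl x′ s (ev Q x) ⟩
        s * (x′ * ev Q x)    ≡⟨ cong (s *_) st ⟩
        s * ev P x           ≡⟨ numerator≡ x ⟩
        (x ^ℚ d) + ev m₁ x   ∎

      denominator-unit : ∀ {x} → 𝒪 x → Unit (1ℚ + ev m₂ x)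
      denominator-unit hx = 1+𝔪-unit (ev∈ 𝔪-submodule m₂ 𝔪m₂ hx)

    step-integral : ∀ {x x′} → 𝒪 x → Step P Q x x′ → 𝒪 x′
    step-integral {x} {x′} hx st = subst 𝒪 eq (𝒪-* (𝒪-+ (𝒪-^ d hx) (𝔪⇒𝒪 (ev∈ 𝔪-submodule m₁ 𝔪m₁ hx))) 𝒪-inverse)
      where
      open Unit (denominator-unit hx)
      eq : ((x ^ℚ d) + ev m₁ x) * inverse ≡ x′
      eq = begin
        ((x ^ℚ d) + ev m₁ x) * inverse     ≡⟨ cong (_* inverse) (sym (step-reduced st)) ⟩
        x′ * (1ℚ + ev m₂ x) * inverse      ≡⟨ ℚₚ.*-assoc x′ (1ℚ + ev m₂ x) inverse ⟩
        x′ * ((1ℚ + ev m₂ x) * inverse)    ≡⟨ cong (x′ *_) x*inverse≡1 ⟩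
        x′ * 1ℚ                            ≡⟨ ℚₚ.*-identityʳ x′ ⟩
        x′                                 ∎

    step-mod-𝔪 : ∀ {x x′} → 𝒪 x → Step P Q x x′ → 𝔪 (x′ - (x ^ℚ d))
    step-mod-𝔪 {x} {x′} hx st = subst 𝔪 eq
      (𝔪-- (ev∈ 𝔪-submodule m₁ 𝔪m₁ hx) (𝔪-*ˡ (step-integral hx st) (ev∈ 𝔪-submodule m₂ 𝔪m₂ hx)))
      where
      eq : ev m₁ x - x′ * ev m₂ x ≡ x′ - (x ^ℚ d)
      eq = begin
        ev m₁ x - x′ * ev m₂ x
          ≡⟨ solve 4 (λ u y v w → u :- y :* v := (w :+ u) :- y :* (con 1ℚ :+ v) :+ y :- w) refl (ev m₁ x) x′ (ev m₂ x) (x ^ℚ d) ⟩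
        ((x ^ℚ d) + ev m₁ x) - x′ * (1ℚ + ev m₂ x) + x′ - (x ^ℚ d)
          ≡⟨ cong (λ u → ((x ^ℚ d) + ev m₁ x) - u + x′ - (x ^ℚ d)) (step-reduced st) ⟩
        ((x ^ℚ d) + ev m₁ x) - ((x ^ℚ d) + ev m₁ x) + x′ - (x ^ℚ d)
          ≡⟨ solve 3 (λ u y w → u :- u :+ y :- w := y :- w) refl ((x ^ℚ d) + ev m₁ x) x′ (x ^ℚ d) ⟩
        x′ - (x ^ℚ d) ∎

    -- The difference quotients of x^d, m₁ and m₂ all lie in 𝔪, the first because p ∣ d, the others
    -- through their coefficients. The term with y′ comes from moving the denominator from y to x.
    step-contracts : ∀ {x x′ y y′} → 𝒪 x → 𝒪 y → 𝔪 (x - y) → Step P Q x x′ → Step P Q y y′ →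
                     ∃[ c ] (𝔪 c × x′ - y′ ≡ (x - y) * c)
    step-contracts {x} {x′} {y} {y′} hx hy h stx sty =
      T * inverse , 𝔪-*ʳ 𝔪T 𝒪-inverse , (begin
        x′ - y′                                      ≡⟨ sym (ℚₚ.*-identityʳ (x′ - y′)) ⟩
        (x′ - y′) * 1ℚ                               ≡⟨ cong ((x′ - y′) *_) (sym x*inverse≡1) ⟩
        (x′ - y′) * ((1ℚ + ev m₂ x) * inverse)       ≡⟨ sym (ℚₚ.*-assoc (x′ - y′) (1ℚ + ev m₂ x) inverse) ⟩
        (x′ - y′) * (1ℚ + ev m₂ x) * inverse         ≡⟨ cong (_* inverse) difference ⟩
        (x - y) * T * inverse                        ≡⟨ ℚₚ.*-assoc (x - y) T inverse ⟩
        (x - y) * (T * inverse)                      ∎)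
      where
      open Unit (denominator-unit hx)
      S = powerQuotient x y d
      q₁ = ev (tail-quotient y m₁) x
      q₂ = ev (tail-quotient y m₂) x
      T = S + q₁ - y′ * q₂
      𝔪q : ∀ m → All 𝔪 m → 𝔪 (ev (tail-quotient y m) x)
      𝔪q m c = ev∈ 𝔪-submodule (tail-quotient y m) (All-tail-quotient 𝔪-submodule hy m c) hx
      𝔪T : 𝔪 T
      𝔪T = 𝔪-- (𝔪-+ (𝔪-powerQuotient (suc k) p∣d hx hy h) (𝔪q m₁ 𝔪m₁)) (𝔪-*ˡ (step-integral hy sty) (𝔪q m₂ 𝔪m₂))
      difference : (x′ - y′) * (1ℚ + ev m₂ x) ≡ (x - y) * T
      difference = begin
        (x′ - y′) * (1ℚ + ev m₂ x)
          ≡⟨ solve 3 (λ a b e → (a :- b) :* e := a :* e :- b :* e) refl x′ y′ (1ℚ + ev m₂ x) ⟩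
        x′ * (1ℚ + ev m₂ x) - y′ * (1ℚ + ev m₂ x)
          ≡⟨ cong₂ (λ u v → u - y′ * (1ℚ + v)) (step-reduced stx) (ev-tail-quotient y m₂ x) ⟩
        (x ^ℚ d) + ev m₁ x - y′ * (1ℚ + (ev m₂ y + (x - y) * q₂))
          ≡⟨ solve 5 (λ u b e f g → u :- b :* (con 1ℚ :+ (e :+ f :* g)) := u :- b :* (con 1ℚ :+ e) :- f :* (b :* g)) refl ((x ^ℚ d) + ev m₁ x) y′ (ev m₂ y) (x - y) q₂ ⟩
        (x ^ℚ d) + ev m₁ x - y′ * (1ℚ + ev m₂ y) - (x - y) * (y′ * q₂)
          ≡⟨ cong₂ (λ u v → (x ^ℚ d) + u - v - (x - y) * (y′ * q₂)) (ev-tail-quotient y m₁ x) (step-reduced sty) ⟩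
        (x ^ℚ d) + (ev m₁ y + (x - y) * q₁) - ((y ^ℚ d) + ev m₁ y) - (x - y) * (y′ * q₂)
          ≡⟨ solve 6 (λ u v e f g h → u :+ (e :+ f :* g) :- (v :+ e) :- f :* h := (u :- v) :+ f :* (g :- h)) refl (x ^ℚ d) (y ^ℚ d) (ev m₁ y) (x - y) q₁ (y′ * q₂) ⟩
        ((x ^ℚ d) - (y ^ℚ d)) + (x - y) * (q₁ - y′ * q₂)
          ≡⟨ cong (_+ (x - y) * (q₁ - y′ * q₂)) (^-difference x y d) ⟩
        (x - y) * S + (x - y) * (q₁ - y′ * q₂)
          ≡⟨ solve 4 (λ f s g h → f :* s :+ f :* (g :- h) := f :* (s :+ g :- h)) refl (x - y) S q₁ (y′ * q₂) ⟩
        (x - y) * T ∎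

    -- Here t = 1/x and 1/x′ = tc, so the orbit of a point outside 𝒪 converges p-adically to ∞.
    step-nonintegral : ∀ {x x′ t} → 𝔪 t → x * t ≡ 1ℚ → Step P Q x x′ → ∃[ c ] (𝔪 c × x′ * (t * c) ≡ 1ℚ)
    step-nonintegral {x} {x′} {t} 𝔪t xt≡1 st = divide (1+𝔪-unit (reverse-value {x = x} 𝔪-submodule ht xt≡1 d m₁ length-m₁ 𝔪m₁))
      where
      ht = 𝔪⇒𝒪 𝔪t
      -- As d = k + 2 and deg m₂ ≤ k, multiplying the denominator by t^d gives t²κ with κ integral.
      -- One factor t is the old reciprocal, the other puts c into 𝔪.
      κ = (t ^ℚ k) + (t ^ℚ k) * ev m₂ x
      μ = (t ^ℚ d) * ev m₁ x
      𝒪κ : 𝒪 κ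
      𝒪κ = 𝒪-+ (𝒪-^ k ht) (𝔪⇒𝒪 (reverse-value {x = x} 𝔪-submodule ht xt≡1 k m₂ length-m₂ 𝔪m₂))
      t^d*x^d : (t ^ℚ d) * (x ^ℚ d) ≡ 1ℚ
      t^d*x^d = trans (sym (*-^ t x d)) (trans (cong (_^ℚ d) (trans (ℚₚ.*-comm t x) xt≡1)) (1^ d))
      scaled-step : x′ * (t * t * κ) ≡ 1ℚ + μ
      scaled-step = begin
        x′ * (t * t * κ)
          ≡⟨ solve 4 (λ x t w e → x :* (t :* t :* (w :+ w :* e)) := t :* (t :* w) :* (x :* (con 1ℚ :+ e))) refl x′ t (t ^ℚ k) (ev m₂ x) ⟩
        (t ^ℚ d) * (x′ * (1ℚ + ev m₂ x))
          ≡⟨ cong ((t ^ℚ d) *_) (step-reduced st) ⟩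
        (t ^ℚ d) * ((x ^ℚ d) + ev m₁ x)
          ≡⟨ ℚₚ.*-distribˡ-+ (t ^ℚ d) (x ^ℚ d) (ev m₁ x) ⟩
        (t ^ℚ d) * (x ^ℚ d) + μ
          ≡⟨ cong (_+ μ) t^d*x^d ⟩
        1ℚ + μ ∎
      divide : Unit (1ℚ + μ) → ∃[ c ] (𝔪 c × x′ * (t * c) ≡ 1ℚ)
      divide (unit v 𝒪v e) = t * κ * v , 𝔪-*ʳ (𝔪-*ʳ 𝔪t 𝒪κ) 𝒪v , (begin
        x′ * (t * (t * κ * v))  ≡⟨ solve 4 (λ x t κ v → x :* (t :* (t :* κ :* v)) := x :* (t :* t :* κ) :* v) refl x′ t κ v ⟩
        x′ * (t * t * κ) * v    ≡⟨ cong (_* v) scaled-step ⟩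
        (1ℚ + μ) * v            ≡⟨ e ⟩
        1ℚ                      ∎)

    module _ (u : ℕ → ℚ) (steps : ∀ n → Step P Q (u n) (u (suc n)))
             (j : ℕ) (returns₀ : u (suc j) ≡ u 0) (returns₁ : u (suc (suc j)) ≡ u 1) where
      private
        escaping : ∀ {t} → 𝔪 t → u 0 * t ≡ 1ℚ → ∀ n → ∃[ c ] (𝔪 c × u (suc n) * (t * c) ≡ 1ℚ)
        escaping 𝔪t e zero = step-nonintegral 𝔪t e (steps 0)
        escaping {t} 𝔪t e (suc n) =
          let c , 𝔪c , e₁ = escaping 𝔪t e n
              c′ , 𝔪c′ , e₂ = step-nonintegral (𝔪-*ˡ (𝔪⇒𝒪 𝔪t) 𝔪c) e₁ (steps (suc n))
          in  c * c′ , 𝔪-*ˡ (𝔪⇒𝒪 𝔪c) 𝔪c′ , trans (cong (u (suc (suc n)) *_) (sym (ℚₚ.*-assoc t c c′))) e₂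

        -- After a full period the accumulated factor c satisfies u₀tc = 1 = u₀t, so 1 = c would lie
        -- in 𝔪.
        ¬escaping : ¬ (∃[ t ] (𝔪 t × u 0 * t ≡ 1ℚ))
        ¬escaping (t , 𝔪t , e) = ¬𝔪-1 (subst 𝔪 (begin
            c               ≡⟨ sym (ℚₚ.*-identityˡ c) ⟩
            1ℚ * c          ≡⟨ cong (_* c) (sym e) ⟩
            u 0 * t * c     ≡⟨ ℚₚ.*-assoc (u 0) t c ⟩
            u 0 * (t * c)   ≡⟨ cong (_* (t * c)) (sym returns₀) ⟩
            u (suc j) * (t * c) ≡⟨ proj₂ (proj₂ (escaping 𝔪t e j)) ⟩
            1ℚ ∎) (proj₁ (proj₂ (escaping 𝔪t e j))))
          where c = proj₁ (escaping 𝔪t e j)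

        integral-orbit : 𝒪 (u 0) → ∀ n → 𝒪 (u n)
        integral-orbit h zero = h
        integral-orbit h (suc n) = step-integral (integral-orbit h n) (steps n)

        module _ (h₀ : 𝒪 (u 0)) where
          h : ∀ n → 𝒪 (u n)
          h = integral-orbit h₀

          -- With uₙ for `u n`, the chain is uₙ₊₂ ≡ uₙ₊₁^d ≡ (uₙ^d)^d ≡ uₙ^d ≡ uₙ₊₁, the third
          -- congruence being idempotence.
          eventually-fixed-mod-𝔪 : ∀ n → 𝔪 (u (suc (suc n)) - u (suc n))
          eventually-fixed-mod-𝔪 n =
            𝔪-trans (u (suc (suc n))) (u (suc n) ^ℚ d) (u (suc n)) (step-mod-𝔪 (h (suc n)) (steps (suc n)))
            (𝔪-trans (u (suc n) ^ℚ d) ((u n ^ℚ d) ^ℚ d) (u (suc n)) (𝔪-^-cong d (h (suc n)) (𝒪-^ d (h n)) (step-mod-𝔪 (h n) (steps n)))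
            (𝔪-trans ((u n ^ℚ d) ^ℚ d) (u n ^ℚ d) (u (suc n)) (idempotent (h n))
            (𝔪-swap (u (suc n)) (u n ^ℚ d) (step-mod-𝔪 (h n) (steps n)))))

          fixed-mod-𝔪 : ∀ n → 𝔪 (u (suc n) - u n)
          -- Idempotence only compares points after the first step, so the pair u 0, u 1 is read off
          -- one full period later.
          fixed-mod-𝔪 zero = subst₂ (λ v w → 𝔪 (v - w)) returns₁ returns₀ (eventually-fixed-mod-𝔪 j)
          fixed-mod-𝔪 (suc n) = eventually-fixed-mod-𝔪 n

          -- The factors are accumulated relative to the first difference, so that n = j compares
          -- this difference with itself.
          contraction : ∀ n → ∃[ c ] (𝔪 c × u (suc (suc n)) - u (suc n) ≡ (u 1 - u 0) * c)
          contraction zero = step-contracts (h 1) (h 0) (fixed-mod-𝔪 0) (steps 1) (steps 0)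
          contraction (suc n) =
            let c , 𝔪c , e = contraction n
                c′ , 𝔪c′ , e′ = step-contracts (h (suc (suc n))) (h (suc n)) (fixed-mod-𝔪 (suc n)) (steps (suc (suc n))) (steps (suc n))
            in  c * c′ , 𝔪-*ˡ (𝔪⇒𝒪 𝔪c) 𝔪c′ , trans e′ (trans (cong (_* c′) e) (ℚₚ.*-assoc (u 1 - u 0) c c′))

          integral-fixed : u 1 ≡ u 0
          integral-fixed = x-y≡0⇒x≡y (u 1) (u 0) (begin
              δ                       ≡⟨ sym (ℚₚ.*-identityʳ δ) ⟩
              δ * 1ℚ                  ≡⟨ cong (δ *_) (sym x*inverse≡1) ⟩
              δ * ((1ℚ + - c) * inverse)  ≡⟨ solve 3 (λ δ c i → δ :* ((con 1ℚ :+ :- c) :* i) := (δ :- δ :* c) :* i) refl δ c inverse ⟩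
              (δ - δ * c) * inverse   ≡⟨ cong (λ v → (δ - v) * inverse) (trans (sym (proj₂ (proj₂ (contraction j)))) (cong₂ _-_ returns₁ returns₀)) ⟩
              (δ - δ) * inverse       ≡⟨ solve 2 (λ δ i → (δ :- δ) :* i := con 0ℚ) refl δ inverse ⟩
              0ℚ                      ∎)
            where
            δ = u 1 - u 0
            c = proj₁ (contraction j)
            open Unit (1+𝔪-unit (𝔪-neg (proj₁ (proj₂ (contraction j)))))

      periodic⇒fixed : u 1 ≡ u 0
      periodic⇒fixed = [ integral-fixed , (λ e → ⊥-elim (¬escaping e)) ]′ (𝒪-or-inverse-𝔪 (u 0))

  periodic-point-fixed : ∀ {d P Q} → 2 ≤ d → MonomialReduction d P Q → p ∣ d → Idempotent d →
    ∀ j x → iter (act P Q) (suc j) x ≡ x → act P Q x ≡ x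
  periodic-point-fixed 2≤d red p∣d idem j ∞ h = refl
  periodic-point-fixed {suc (suc k)} {P} {Q} 2≤d red p∣d idem j (fin x) h =
    trans (proj₂ (orbit 1)) (trans (cong fin (periodic⇒fixed red p∣d idem u
      (λ n → step (act-fin P Q (trans (cong g (sym (proj₂ (orbit n)))) (proj₂ (orbit (suc n)))))) j
      (fin-injective (trans (sym (proj₂ (orbit (suc j)))) h))
      (fin-injective (trans (sym (proj₂ (orbit (suc (suc j))))) (trans (cong g h) (proj₂ (orbit 1)))))))
      refl)
    where
    g = act P Q
    orbit = periodic-finite P Q j h
    u : ℕ → ℚ
    u n = proj₁ (orbit n)
  periodic-point-fixed {suc zero} (s≤s ()) red p∣d idem j (fin x) h

-- Assembling the three cases

divides-p^ : ∀ {p d} ℓ → 2 ≤ d → d ≡ p ^ ℓ → p ∣ d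
divides-p^ zero (s≤s ()) refl
divides-p^ {p} (suc ℓ) 2≤d e = subst (p ∣_) (sym e) (m∣m*n (p ^ ℓ))

theorem6p1 : (d e₁ e₂ e₃ : ℕ) (P Q : Poly) → IsNormalizedBelyi d e₁ e₂ e₃ P Q →
    (p ℓ : ℕ) → Prime p →
    ((p ≡ 2 × 2 ∣ d × ValIs 2 d ℓ) ⊎ (p ≡ 3 × 3 ∣ d × ValIs 3 d ℓ) ⊎ (d ≡ p ^ ℓ)) →
    e₂ ≤ p ^ ℓ →
    (x : ℙ¹) → IsPreperiodic (act P Q) x →
    ∃[ m ] (iter (act P Q) m x ≡ iter (act P Q) (suc m) x)
theorem6p1 d e₁ e₂ e₃ P Q belyi p ℓ pp cases e₂≤ = preperiodic⇒eventually-fixed (act P Q)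
  (conclude cases)
  where
  open IsNormalizedBelyi belyi
  open AtPrime p pp
  2≤d = ℕₚ.≤-trans 2≤e₁ e₁≤d
  fixes : ∀ n → d ≡ n ℕ.* p ^ ℓ → p ∣ d → Idempotent d → ∀ j x → iter (act P Q) (suc j) x ≡ x → act P Q x ≡ x
  fixes n d≡ = periodic-point-fixed 2≤d (monomialReduction belyi n ℓ d≡ e₂≤)
  at-d : (∀ n → Idempotent (suc n)) → Idempotent d
  at-d h = subst (Idempotent) (ℕₚ.suc-pred d {{ℕ.>-nonZero (ℕₚ.≤-trans (s≤s z≤n) 2≤d)}}) (h (ℕ.pred d))
  conclude : ((p ≡ 2 × 2 ∣ d × ValIs 2 d ℓ) ⊎ (p ≡ 3 × 3 ∣ d × ValIs 3 d ℓ) ⊎ (d ≡ p ^ ℓ)) →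
             ∀ j x → iter (act P Q) (suc j) x ≡ x → act P Q x ≡ x
  -- The quotient `n` = d / p^ℓ is the exponent in x^d = (x^(p^ℓ))^n, through which x^d - 1 is
  -- compared with (x - 1)^(p^ℓ).
  conclude (inj₁ (refl , 2∣d , (divides n d≡ , _))) = fixes n d≡ 2∣d (at-d (idempotent-2 refl))
  conclude (inj₂ (inj₁ (refl , 3∣d , (divides n d≡ , _)))) = fixes n d≡ 3∣d (at-d (idempotent-3 refl))
  conclude (inj₂ (inj₂ d≡)) = fixes 1 (trans d≡ (sym (ℕₚ.*-identityˡ (p ^ ℓ)))) (divides-p^ ℓ 2≤d d≡)
    (subst (Idempotent) (sym d≡) (idempotent-p^ ℓ))
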